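{- In the 2-sided error regime, there exists an algorithm that, given a moldgraph with $m$ edges, finds a realized spanning tree with high probability using $O(m\log m)$ queries. Moreover, no algorithm can do better than $\Omega(m\log m)$ queries.
   Context: Problem (graph connectivity with noisy queries): a graph $G=(V,E)$, the moldgraph, with $n$ vertices and $m$ edges is given. An adversary selects an arbitrary connected spanning subgraph $G'$ of $G$ to be realized; its edges are called realized. The algorithm does not observe $G'$, but may query an oracle on any edge $e\in E$ (``Is $e$ realized?''), receiving ``Yes'' or ``No''; each query costs $1$, and answers to distinct queries (including repeated queries of the same edge) are independent random. The goal is to output a spanning tree of $G$ all of whose edges are realized, using as few queries as possible. In the 2-sided error regime, each answer is wrong (``No'' for a realized edge, ``Yes'' for a non-realized edge) with a constant probability $p<1/2$. ``With high probability'' means with probability tending to $1$ as $m\to\infty$. The lower bound is a worst-case statement over moldgraphs and realized subgraphs, for algorithms succeeding with constant failure probability. -}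

module Defs where

open import Algebra.Bundles using (CommutativeRing)
import Algebra.Definitions.RawMonoid as RawMonoid
open import Data.Bool using (Bool; true; false; not; if_then_else_)
open import Data.Fin using (Fin; zero; suc)
import Data.Fin as Fin
open import Data.Fin.Properties using (all?; any?; _≟_; injective⇒≤)
open import Data.Fin.Subset using (Subset; ⊤; _∈_; _⊆_)
open import Data.Fin.Subset.Properties using (_∈?_; _⊆?_)
open import Data.List
  using (List; []; _∷_; _∷ʳ_; [_]; length; lookup; filter; cartesianProduct; allFin)
open import Data.List.Membership.Propositional renaming (_∈_ to _∈ˡ_) using ()
open import Data.List.Membership.Propositional.Properties
  using (∈-filter⁺; ∈-filter⁻; ∈-cartesianProduct⁺; ∈-allFin; ∈-lookup)
open import Data.List.Relation.Unary.All as All using ()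
open import Data.List.Relation.Unary.AllPairs using (_∷_)
open import Data.List.Relation.Unary.Any using (here; there)
open import Data.List.Relation.Unary.Linked using (Linked; linked?)
open import Data.List.Relation.Unary.Unique.Propositional using (Unique)
import Data.List.Relation.Unary.Unique.DecPropositional as DecUnique
open import Data.Nat as ℕ using (ℕ; zero; suc; z≤n; s≤s; s≤s⁻¹)
import Data.Nat.Properties as ℕ
open import Data.Product using (∃-syntax; _×_; _,_; proj₂; uncurry)
open import Data.Product.Properties using (≡-dec)
open import Data.Sum using (_⊎_; inj₁; inj₂)
open import Data.Vec as Vec using ()
open import Function using (_∘_; Injective)
open import Level using (Level; _⊔_) renaming (suc to lsuc)
open import Relation.Binary using (Rel; Decidable; IsDecTotalOrder)
open import Relation.Binary.Construct.Closure.ReflexiveTransitive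
  using (Star; ε; _◅_; _◅◅_; gmap)
open import Relation.Binary.PropositionalEquality
  using (_≡_; refl; sym; cong)
open import Relation.Nullary using (¬_; Dec; yes; no; does; contradiction)
open import Relation.Nullary.Decidable using (map′; ¬?; _×-dec_; _⊎-dec_)
import Relation.Unary as U

-- Probabilities and error tolerances are taken in an arbitrary such field;
-- classically, the field of real numbers is one.

record ArchimedeanOrderedField (c ℓ₁ ℓ₂ : Level) : Set (lsuc (c ⊔ ℓ₁ ⊔ ℓ₂)) where
  infix 4 _≤_ _<_

  field
    commutativeRing : CommutativeRing c ℓ₁

  open CommutativeRing commutativeRing public
  open RawMonoid +-rawMonoid public using () renaming (_×_ to _×ℕ_)

  field
    0≉1             : 0# ≉ 1#
    inverse         : ∀ x → x ≉ 0# → ∃[ y ] x * y ≈ 1#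
    _≤_             : Rel Carrier ℓ₂
    isDecTotalOrder : IsDecTotalOrder _≈_ _≤_
    +-monoˡ-≤       : ∀ z {x y} → x ≤ y → x + z ≤ y + z
    *-nonNegative   : ∀ {x y} → 0# ≤ x → 0# ≤ y → 0# ≤ x * y
    archimedean     : ∀ x → ∃[ k ] x ≤ k ×ℕ 1#

  _<_ : Rel Carrier (ℓ₁ ⊔ ℓ₂)
  x < y = x ≤ y × x ≉ y

-- A finite simple graph on Fin n: edge e is the unordered pair of its endpoints, listed in increasing
-- order, so loops are excluded and, by injectivity, so are parallel edges.

record Graph (n m : ℕ) : Set where
  field
    ends           : Fin m → Fin n × Fin n
    ends-<         : ∀ e → uncurry Fin._<_ (ends e)
    ends-injective : Injective _≡_ _≡_ ends

module _ {n m : ℕ} (G : Graph n m) where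
  open Graph G

  -- A set S of edges stands for the spanning subgraph (Fin n, S) of G.

  Adj : Subset m → Rel (Fin n) _
  Adj S u v = ∃[ e ] e ∈ S × (ends e ≡ (u , v) ⊎ ends e ≡ (v , u))

  Connected : Subset m → Set
  Connected S = ∀ u v → Star (Adj S) u v

  -- The cycle through u , v₁ , … , vₖ and back to u has length 1 + k ≥ 3.

  IsCycle : Subset m → Fin n → List (Fin n) → Set
  IsCycle S u vs =
    2 ℕ.≤ length vs × Unique (u ∷ vs) × Linked (Adj S) (u ∷ vs ∷ʳ u)

  Acyclic : Subset m → Set
  Acyclic S = ∀ u → ¬ (∃[ vs ] IsCycle S u vs)

  IsSpanningTree : Subset m → Set
  IsSpanningTree T = Connected T × Acyclic T

  IsRealizedSpanningTree : (R T : Subset m) → Set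
  IsRealizedSpanningTree R T = T ⊆ R × IsSpanningTree T

record Moldgraph (n m : ℕ) : Set where
  field
    graph     : Graph n m
    connected : Connected graph ⊤
  open Graph graph public

private

  -- Reachability along an explicit list of arcs, deleting one arc at a time.

  Arc : ∀ {n} → List (Fin n × Fin n) → Rel (Fin n) _
  Arc as u v = (u , v) ∈ˡ as

  split : ∀ {n a b u v} {as : List (Fin n × Fin n)} →
          Star (Arc ((a , b) ∷ as)) u v →
          Star (Arc as) u v ⊎ Star (Arc as) u a × Star (Arc as) b v
  split ε = inj₁ ε
  split (here refl ◅ r) with split r
  ... | inj₁ s       = inj₂ (ε , s)
  ... | inj₂ (_ , t) = inj₂ (ε , t)
  split (there i ◅ r) with split r
  ... | inj₁ s       = inj₁ (i ◅ s)
  ... | inj₂ (s , t) = inj₂ (i ◅ s , t)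

  join : ∀ {n a b u v} {as : List (Fin n × Fin n)} →
         Star (Arc as) u v ⊎ Star (Arc as) u a × Star (Arc as) b v →
         Star (Arc ((a , b) ∷ as)) u v
  join (inj₁ s)       = gmap _ there s
  join (inj₂ (s , t)) = gmap _ there s ◅◅ (here refl ◅ gmap _ there t)

  arcStar? : ∀ {n} (as : List (Fin n × Fin n)) → Decidable (Star (Arc as))
  arcStar? [] u v = map′ (λ { refl → ε }) (λ { ε → refl }) (u ≟ v)
  arcStar? ((a , b) ∷ as) u v =
    map′ join split (arcStar? as u v ⊎-dec (arcStar? as u a ×-dec arcStar? as b v))

  star? : ∀ {n ℓ} {_~_ : Rel (Fin n) ℓ} → Decidable _~_ → Decidable (Star _~_)
  star? {n} {_~_ = _~_} _~?_ u v =
    map′ (gmap _ (proj₂ ∘ ∈-filter⁻ arc? {xs = pairs}))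
         (gmap _ (∈-filter⁺ arc? (∈-cartesianProduct⁺ (∈-allFin _) (∈-allFin _))))
         (arcStar? (filter arc? pairs) u v)
    where
    arc? : U.Decidable (uncurry _~_)
    arc? (x , y) = x ~? y

    pairs : List (Fin n × Fin n)
    pairs = cartesianProduct (allFin n) (allFin n)

  bounded? : ∀ {n ℓ} {P : List (Fin n) → Set ℓ} k → U.Decidable P →
             Dec (∃[ xs ] length xs ℕ.≤ k × P xs)
  bounded? zero P? =
    map′ (λ p → [] , z≤n , p) (λ { ([] , _ , p) → p }) (P? [])
  bounded? (suc k) P? =
    map′ (λ { (inj₁ p)                → [] , z≤n , p
            ; (inj₂ (x , xs , l , p)) → x ∷ xs , s≤s l , p })
         (λ { ([] , _ , p)            → inj₁ p
            ; (x ∷ xs , l , p)        → inj₂ (x , xs , s≤s⁻¹ l , p) })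
         (P? [] ⊎-dec any? (λ x → bounded? k (P? ∘ (x ∷_))))

  lookup-injective : ∀ {a} {A : Set a} {xs : List A} → Unique xs →
                     Injective _≡_ _≡_ (lookup xs)
  lookup-injective {xs = _ ∷ _} _ {zero} {zero} _ = refl
  lookup-injective {xs = _ ∷ xs} (x∉ ∷ _) {zero} {suc j} eq =
    contradiction eq (All.lookup x∉ (∈-lookup {xs = xs} j))
  lookup-injective {xs = _ ∷ xs} (x∉ ∷ _) {suc i} {zero} eq =
    contradiction (sym eq) (All.lookup x∉ (∈-lookup {xs = xs} i))
  lookup-injective {xs = _ ∷ _} (_ ∷ u) {suc i} {suc j} eq =
    cong suc (lookup-injective u eq)

module _ {n m : ℕ} (G : Graph n m) where
  open Graph G

  adj? : ∀ S → Decidable (Adj G S)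
  adj? S u v = any? λ e →
    (e ∈? S) ×-dec (≡-dec _≟_ _≟_ (ends e) (u , v) ⊎-dec ≡-dec _≟_ _≟_ (ends e) (v , u))

  connected? : U.Decidable (Connected G)
  connected? S = all? λ u → all? λ v → star? (adj? S) u v

  isCycle? : ∀ S u → U.Decidable (IsCycle G S u)
  isCycle? S u vs =
    (2 ℕ.≤? length vs) ×-dec
    (DecUnique.unique? _≟_ (u ∷ vs) ×-dec linked? (adj? S) (u ∷ vs ∷ʳ u))

  acyclic? : U.Decidable (Acyclic G)
  acyclic? S = all? λ u → ¬? (map′ (λ { (vs , _ , c) → vs , c })
                                   (λ { (vs , c) → vs , short c , c })
                                   (bounded? n (isCycle? S u)))
    where
    short : ∀ {u vs} → IsCycle G S u vs → length vs ℕ.≤ n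
    short (_ , uniq , _) =
      ℕ.≤-trans (ℕ.n≤1+n _) (injective⇒≤ (lookup-injective uniq))

  isRealizedSpanningTree? : ∀ R → U.Decidable (IsRealizedSpanningTree G R)
  isRealizedSpanningTree? R T = (T ⊆? R) ×-dec (connected? T ×-dec acyclic? T)

module Querying {c ℓ₁ ℓ₂} (K : ArchimedeanOrderedField c ℓ₁ ℓ₂) where
  open ArchimedeanOrderedField K

  -- A randomized adaptive strategy on edge set Fin m, as a decision tree:
  -- a query branches on the answer (true is "Yes"), a flip branches on a
  -- private coin showing true with probability r.

  data Strategy (m : ℕ) : Set (c ⊔ ℓ₂) where
    output : Subset m → Strategy m
    query  : Fin m → (Bool → Strategy m) → Strategy m
    flip   : (r : Carrier) → 0# ≤ r → r ≤ 1# → (Bool → Strategy m) → Strategy m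

  Algorithm : Set (c ⊔ ℓ₂)
  Algorithm = ∀ {n m} → Moldgraph n m → Strategy m

  worstCaseQueries : ∀ {m} → Strategy m → ℕ
  worstCaseQueries (output _)     = 0
  worstCaseQueries (query _ k)    =
    suc (worstCaseQueries (k true) ℕ.⊔ worstCaseQueries (k false))
  worstCaseQueries (flip _ _ _ k) =
    worstCaseQueries (k true) ℕ.⊔ worstCaseQueries (k false)

  -- The probability that the output satisfies P when the set of realized
  -- edges is R and each answer is wrong, independently, with probability p.

  Pr : ∀ {m ℓ} {P : U.Pred (Subset m) ℓ} →
       Carrier → Subset m → U.Decidable P → Strategy m → Carrier
  Pr p R P? (output T)     = if does (P? T) then 1# else 0#
  Pr p R P? (query e k)    =
    (1# - p) * Pr p R P? (k truth) + p * Pr p R P? (k (not truth))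
    where
    truth : Bool
    truth = Vec.lookup R e
  Pr p R P? (flip r _ _ k) =
    r * Pr p R P? (k true) + (1# - r) * Pr p R P? (k false)

  successProbability : ∀ {n m} → Carrier → Moldgraph n m → Subset m → Strategy m → Carrier
  successProbability p G R = Pr p R (isRealizedSpanningTree? (Moldgraph.graph G) R)

  SucceedsOnSize : Carrier → Algorithm → (m : ℕ) → Carrier → Set ℓ₂
  SucceedsOnSize p A m δ =
    ∀ {n} (G : Moldgraph n m) (R : Subset m) → Connected (Moldgraph.graph G) R →
    1# - δ ≤ successProbability p G R (A G)

  SucceedsWithHighProbability : Carrier → Algorithm → Set (c ⊔ ℓ₁ ⊔ ℓ₂)
  SucceedsWithHighProbability p A =
    ∀ δ → 0# < δ → ∃[ m₀ ] ∀ m → m₀ ℕ.≤ m → SucceedsOnSize p A m δ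

-- Upper bound: a majority of k answers is wrong with probability at most ρ^k for some ρ < 1, by an
-- exponential-moment argument. With k of order log m, a union bound over the m edges recovers all of
-- G', and deleting edges from it while it stays connected leaves a spanning tree.
--
-- Lower bound: on a union of Θ(m) two-edge gadgets, each hiding one uniform bit, the posterior stays a
-- product, and after c answers about a bit the ratio of its two weights is at least p^c. Hence an
-- output is right with probability at most ∏ᵢ (1 + p^cᵢ)⁻¹ ≤ (1 + ∑ᵢ p^cᵢ)⁻¹. If ∑ᵢ cᵢ is below a small
-- multiple of m log m, then p^cᵢ ≥ m^(-1/2) for a constant fraction of the bits, and ∑ᵢ p^cᵢ grows
-- like √m.

module Submission where

-- An Archimedean ordered field need not contain square roots or logarithms, so every estimate is
-- arranged without them and mostly without division: inequalities are multiplied out and closed by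
-- a ring identity with a nonnegative slack. For polling, the optimal exponential weight, the square
-- root of (1 - p) / p, is replaced by 1 + (1 - 2p), which also makes sense at p = 0. For the lower
-- bound, an integer j with 2^j p at least 1 stands in for the logarithm of 1/p. Both error analyses
-- are inductions over decision trees. Posterior weights stay unnormalised: they are joint weights
-- of the transcript and the hidden bits, and they add up over the two answers to a query, so no
-- conditional probability is ever formed. Private coins do not help, since the bound survives
-- convex combinations. In the hard graph every spoke has exactly one realized edge, which each
-- realized spanning tree must use, so a successful output betrays all hidden bits. The lower bound
-- assumes p positive because truthful answers would make m queries enough.

open import Defs
open import Algebra.Bundles using (CommutativeRing; RawRing)
import Algebra.Properties.AbelianGroup as AbelianGroupProperties
import Algebra.Properties.CommutativeSemigroup as CommutativeSemigroupProperties
import Algebra.Properties.CommutativeSemiring.Exp as Exp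
import Algebra.Properties.Ring as RingProperties
import Algebra.Properties.Semiring.Mult as Multiple
import Algebra.Properties.Semiring.Mult.TCOptimised as OptimisedMultiple
import Algebra.Solver.Ring as RingSolver
open import Algebra.Solver.Ring.AlmostCommutativeRing
  using (_-Raw-AlmostCommutative⟶_; fromCommutativeRing)
open import Data.Bool using (Bool; true; false; not; if_then_else_)
import Data.Bool as Bool
open import Data.Empty using (⊥-elim)
open import Data.Fin using (Fin; zero; suc)
import Data.Fin as Fin
import Data.Fin.Properties as Fin
open import Data.Fin.Subset using (Subset; ⊤; _∈_; _⊆_; ∣_∣) renaming (_-_ to _∖_)
import Data.Fin.Subset.Properties as Subset
open import Data.List using ([]; _∷_; _∷ʳ_)
open import Data.List.Relation.Unary.All as All using (All; []; _∷_)
open import Data.List.Relation.Unary.AllPairs using (_∷_)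
open import Data.List.Relation.Unary.Linked using (Linked; _∷_)
open import Data.Maybe using (Maybe; just; nothing)
open import Data.Nat as ℕ using (ℕ; zero; suc; z≤n; s≤s; ⌊_/2⌋; ⌈_/2⌉)
open import Data.Nat.Induction using (<-wellFounded)
import Data.Nat.DivMod as ℕ
import Data.Nat.Properties as ℕ
open import Data.Nat.Logarithm
import Data.Nat.Solver as ℕSolver
open import Data.Product using (Σ-syntax; ∃-syntax; _×_; _,_; proj₁; proj₂)
open import Data.Sum using (_⊎_; inj₁; inj₂)
open import Data.Vec as Vec using (Vec; []; _∷_)
import Data.Vec.Properties as Vec
open import Function using (_∘_; id)
open import Induction.WellFounded using (Acc; acc)
open import Level using (Level; _⊔_)
open import Relation.Binary using (Poset; IsDecTotalOrder)
open import Relation.Binary.Construct.Closure.ReflexiveTransitive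
  using (Star; ε; _◅_; _◅◅_; gmap; kleisliStar; reverse)
open import Relation.Binary.PropositionalEquality as ≡
  using (_≡_; _≢_; refl; cong; cong₂; subst)
import Relation.Binary.Reasoning.PartialOrder as PartialOrderReasoning
import Relation.Binary.Reasoning.Setoid as SetoidReasoning
open import Relation.Nullary using (¬_; Dec; yes; no; does; contradiction; ofʸ; ofⁿ)
open import Relation.Nullary.Decidable using (dec-true; dec-false; _×-dec_)
import Relation.Unary as U

-- The standard ring solver needs coefficients with decidable equality to cancel x - x. The pair
-- (m , n) stands for the difference m - n; ⟦ m , 0 ⟧ is the bare multiple so that the solver's
-- constants 0 and 1 denote 0# and 1# definitionally, and sums and products are reduced because the
-- solver compares normal forms syntactically.

module IntegerCoefficients {c ℓ} (R : CommutativeRing c ℓ) where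
  open CommutativeRing R hiding (refl; zero)
  open CommutativeRing R using () renaming (refl to ≈-refl)
  open OptimisedMultiple semiring renaming (_×_ to _·_)
  open RingProperties ring using (-‿distribˡ-*; -‿distribʳ-*)
  open AbelianGroupProperties +-abelianGroup using (⁻¹-∙-comm; ⁻¹-involutive; ε⁻¹≈ε)
  open CommutativeSemigroupProperties +-commutativeSemigroup using (interchange)
  open SetoidReasoning setoid

  reduce : ℕ → ℕ → ℕ × ℕ
  reduce m n = m ℕ.∸ n , n ℕ.∸ m

  Differences : RawRing _ _
  Differences = record
    { Carrier = ℕ × ℕ
    ; _≈_     = _≡_
    ; _+_     = λ (a , b) (c , d) → reduce (a ℕ.+ c) (b ℕ.+ d)
    ; _*_     = λ (a , b) (c , d) → reduce (a ℕ.* c ℕ.+ b ℕ.* d) (a ℕ.* d ℕ.+ b ℕ.* c)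
    ; -_      = λ (a , b) → b , a
    ; 0#      = 0 , 0
    ; 1#      = 1 , 0
    }

  ⟦_⟧ : ℕ × ℕ → Carrier
  ⟦ m , zero ⟧  = m · 1#
  ⟦ m , suc n ⟧ = m · 1# - suc n · 1#

  ⟦⟧-difference : ∀ m n → ⟦ m , n ⟧ ≈ m · 1# - n · 1#
  ⟦⟧-difference m zero    = sym (trans (+-congˡ ε⁻¹≈ε) (+-identityʳ _))
  ⟦⟧-difference m (suc n) = ≈-refl

  +-difference : ∀ x y u v → (x + y) - (u + v) ≈ (x - u) + (y - v)
  +-difference x y u v = trans (+-congˡ (sym (⁻¹-∙-comm u v))) (interchange x y (- u) (- v))

  *-difference : ∀ x y u v → (x * u + y * v) - (x * v + y * u) ≈ (x - y) * (u - v)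
  *-difference x y u v = begin
    (x * u + y * v) - (x * v + y * u)           ≈⟨ +-difference _ _ _ _ ⟩
    (x * u - x * v) + (y * v - y * u)           ≈⟨ +-cong (+-congˡ (-‿distribʳ-* x v)) (+-comm _ _) ⟩
    (x * u + x * - v) + (- (y * u) + y * v)     ≈⟨ +-cong (distribˡ x u (- v)) lemma ⟨
    x * (u - v) + - y * (u - v)                 ≈⟨ distribʳ _ _ _ ⟨
    (x - y) * (u - v)                           ∎
    where
    lemma : - y * (u - v) ≈ - (y * u) + y * v
    lemma = begin
      - y * (u - v)              ≈⟨ distribˡ _ _ _ ⟩
      - y * u + - y * - v        ≈⟨ +-cong (-‿distribˡ-* y u) (-‿distribˡ-* y (- v)) ⟨
      - (y * u) + - (y * - v)    ≈⟨ +-congˡ (-‿cong (-‿distribʳ-* y v)) ⟨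
      - (y * u) + - - (y * v)    ≈⟨ +-congˡ (⁻¹-involutive _) ⟩
      - (y * u) + y * v          ∎

  ⟦reduce⟧ : ∀ m n → ⟦ reduce m n ⟧ ≈ m · 1# - n · 1#
  ⟦reduce⟧ zero    zero    = ⟦⟧-difference zero zero
  ⟦reduce⟧ zero    (suc n) = ≈-refl
  ⟦reduce⟧ (suc m) zero    = ⟦⟧-difference (suc m) zero
  ⟦reduce⟧ (suc m) (suc n) = begin
    ⟦ reduce m n ⟧                        ≈⟨ ⟦reduce⟧ m n ⟩
    m · 1# - n · 1#                       ≈⟨ +-identityˡ _ ⟨
    0# + (m · 1# - n · 1#)                ≈⟨ +-congʳ (-‿inverseʳ 1#) ⟨
    (1# - 1#) + (m · 1# - n · 1#)         ≈⟨ +-difference _ _ _ _ ⟨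
    (1# + m · 1#) - (1# + n · 1#)         ≈⟨ +-cong (1+× m 1#) (-‿cong (1+× n 1#)) ⟨
    suc m · 1# - suc n · 1#               ∎

  homomorphism : Differences -Raw-AlmostCommutative⟶ fromCommutativeRing R
  homomorphism = record
    { ⟦_⟧    = ⟦_⟧
    ; +-homo = λ (a , b) (c , d) → begin
        ⟦ reduce (a ℕ.+ c) (b ℕ.+ d) ⟧                  ≈⟨ ⟦reduce⟧ (a ℕ.+ c) (b ℕ.+ d) ⟩
        (a ℕ.+ c) · 1# - (b ℕ.+ d) · 1#
          ≈⟨ +-cong (×-homo-+ 1# a c) (-‿cong (×-homo-+ 1# b d)) ⟩
        (a · 1# + c · 1#) - (b · 1# + d · 1#)           ≈⟨ +-difference _ _ _ _ ⟩
        (a · 1# - b · 1#) + (c · 1# - d · 1#)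
          ≈⟨ +-cong (⟦⟧-difference a b) (⟦⟧-difference c d) ⟨
        ⟦ a , b ⟧ + ⟦ c , d ⟧                           ∎
    ; *-homo = λ (a , b) (c , d) → begin
        ⟦ reduce (a ℕ.* c ℕ.+ b ℕ.* d) (a ℕ.* d ℕ.+ b ℕ.* c) ⟧
          ≈⟨ ⟦reduce⟧ (a ℕ.* c ℕ.+ b ℕ.* d) (a ℕ.* d ℕ.+ b ℕ.* c) ⟩
        (a ℕ.* c ℕ.+ b ℕ.* d) · 1# - (a ℕ.* d ℕ.+ b ℕ.* c) · 1#
          ≈⟨ +-cong (sum-of-products a c b d) (-‿cong (sum-of-products a d b c)) ⟩
        (a · 1# * c · 1# + b · 1# * d · 1#) - (a · 1# * d · 1# + b · 1# * c · 1#)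
          ≈⟨ *-difference _ _ _ _ ⟩
        (a · 1# - b · 1#) * (c · 1# - d · 1#)
          ≈⟨ *-cong (⟦⟧-difference a b) (⟦⟧-difference c d) ⟨
        ⟦ a , b ⟧ * ⟦ c , d ⟧ ∎
    ; -‿homo = λ (a , b) → begin
        ⟦ b , a ⟧                   ≈⟨ ⟦⟧-difference b a ⟩
        b · 1# - a · 1#             ≈⟨ +-comm _ _ ⟩
        - (a · 1#) + b · 1#         ≈⟨ +-congˡ (⁻¹-involutive _) ⟨
        - (a · 1#) + - - (b · 1#)   ≈⟨ ⁻¹-∙-comm _ _ ⟩
        - (a · 1# - b · 1#)         ≈⟨ -‿cong (⟦⟧-difference a b) ⟨
        - ⟦ a , b ⟧                 ∎
    ; 0-homo = ≈-refl
    ; 1-homo = ≈-refl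
    }
    where
    sum-of-products : ∀ a c b d → (a ℕ.* c ℕ.+ b ℕ.* d) · 1# ≈ a · 1# * c · 1# + b · 1# * d · 1#
    sum-of-products a c b d =
      trans (×-homo-+ 1# (a ℕ.* c) (b ℕ.* d)) (+-cong (×1-homo-* a c) (×1-homo-* b d))

  equal? : ∀ x y → Maybe (⟦ x ⟧ ≈ ⟦ y ⟧)
  equal? (a , b) (c , d) with a ℕ.+ d ℕ.≟ c ℕ.+ b
  ... | no _  = nothing
  ... | yes e = just (begin
    ⟦ a , b ⟧                                 ≈⟨ ⟦⟧-difference a b ⟩
    a · 1# - b · 1#                           ≈⟨ shift d ⟩
    (a · 1# + d · 1#) - (b · 1# + d · 1#)     ≈⟨ +-cong ad≈cb (-‿cong (+-comm _ _)) ⟩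
    (c · 1# + b · 1#) - (d · 1# + b · 1#)     ≈⟨ shift b ⟨
    c · 1# - d · 1#                           ≈⟨ ⟦⟧-difference c d ⟨
    ⟦ c , d ⟧                                 ∎)
    where
    shift : ∀ {x y} k → x - y ≈ (x + k · 1#) - (y + k · 1#)
    shift k = sym (trans (+-difference _ _ _ _) (trans (+-congˡ (-‿inverseʳ _)) (+-identityʳ _)))

    ad≈cb : a · 1# + d · 1# ≈ c · 1# + b · 1#
    ad≈cb = trans (sym (×-homo-+ 1# a d))
                  (trans (reflexive (cong (_· 1#) e)) (×-homo-+ 1# c b))

  open RingSolver Differences (fromCommutativeRing R) homomorphism equal? public
    using (Polynomial; solve; _:=_; _:+_; _:*_; _:-_; con)

  one : ∀ {n} → Polynomial n
  one = con (1 , 0)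

-- Arithmetic in an Archimedean ordered field.

module OrderedField {c ℓ₁ ℓ₂} (K : ArchimedeanOrderedField c ℓ₁ ℓ₂) where
  open ArchimedeanOrderedField K hiding (refl; zero)
  open IsDecTotalOrder isDecTotalOrder public
    using (total; antisym)
    renaming (refl to ≤-refl; reflexive to ≤-reflexive; trans to ≤-trans)
  open Exp commutativeSemiring public using (_^_; ^-assocʳ; ^-distrib-*)
  open Multiple semiring using (×-homo-+; ×1-homo-*)
  open IntegerCoefficients commutativeRing public

  poset : Poset c ℓ₁ ℓ₂
  poset = record { isPartialOrder = IsDecTotalOrder.isPartialOrder isDecTotalOrder }

  open PartialOrderReasoning poset

  ≈-refl : ∀ {x} → x ≈ x
  ≈-refl = ArchimedeanOrderedField.refl K

  ι : ℕ → Carrier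
  ι n = n ×ℕ 1#

  +-mono-≤ : ∀ {x y u v} → x ≤ y → u ≤ v → x + u ≤ y + v
  +-mono-≤ {x} {y} {u} {v} x≤y u≤v = begin
    x + u  ≤⟨ +-monoˡ-≤ u x≤y ⟩
    y + u  ≈⟨ +-comm y u ⟩
    u + y  ≤⟨ +-monoˡ-≤ y u≤v ⟩
    v + y  ≈⟨ +-comm v y ⟩
    y + v  ∎

  x≤x+d : ∀ {d} x → 0# ≤ d → x ≤ x + d
  x≤x+d {d} x 0≤d = begin
    x       ≈⟨ +-identityʳ x ⟨
    x + 0#  ≤⟨ +-mono-≤ ≤-refl 0≤d ⟩
    x + d   ∎

  -- Turns an inequality into a ring identity with an explicit nonnegative slack `d`, which the
  -- solver can check.
  ≤-excess : ∀ {x y d} → 0# ≤ d → x + d ≈ y → x ≤ y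
  ≤-excess {x} 0≤d x+d≈y = ≤-trans (x≤x+d x 0≤d) (≤-reflexive x+d≈y)

  0≤y-x : ∀ {x y} → x ≤ y → 0# ≤ y - x
  0≤y-x {x} {y} x≤y = begin
    0#     ≈⟨ -‿inverseʳ x ⟨
    x - x  ≤⟨ +-monoˡ-≤ (- x) x≤y ⟩
    y - x  ∎

  +-nonNegative : ∀ {x y} → 0# ≤ x → 0# ≤ y → 0# ≤ x + y
  +-nonNegative 0≤x 0≤y = ≤-trans 0≤x (x≤x+d _ 0≤y)

  *-monoʳ-≤ : ∀ {x y z} → 0# ≤ z → x ≤ y → z * x ≤ z * y
  *-monoʳ-≤ {x} {y} {z} 0≤z x≤y = ≤-excess (*-nonNegative 0≤z (0≤y-x x≤y))
    (solve 3 (λ x y z → z :* x :+ z :* (y :- x) := z :* y) ≈-refl x y z)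

  *-monoˡ-≤ : ∀ {x y z} → 0# ≤ z → x ≤ y → x * z ≤ y * z
  *-monoˡ-≤ {x} {y} {z} 0≤z x≤y = begin
    x * z  ≈⟨ *-comm x z ⟩
    z * x  ≤⟨ *-monoʳ-≤ 0≤z x≤y ⟩
    z * y  ≈⟨ *-comm z y ⟩
    y * z  ∎

  *-mono-≤ : ∀ {x y u v} → 0# ≤ u → 0# ≤ y → x ≤ y → u ≤ v → x * u ≤ y * v
  *-mono-≤ 0≤u 0≤y x≤y u≤v = ≤-trans (*-monoˡ-≤ 0≤u x≤y) (*-monoʳ-≤ 0≤y u≤v)

  <⇒≱ : ∀ {x y} → x < y → ¬ y ≤ x
  <⇒≱ (x≤y , x≉y) y≤x = x≉y (antisym x≤y y≤x)

  ≰⇒> : ∀ {x y} → ¬ x ≤ y → y < x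
  ≰⇒> {x} {y} x≰y with total x y
  ... | inj₁ x≤y = contradiction x≤y x≰y
  ... | inj₂ y≤x = y≤x , λ y≈x → x≰y (≤-reflexive (sym y≈x))

  0≤1 : 0# ≤ 1#
  0≤1 with total 0# 1#
  ... | inj₁ 0≤1 = 0≤1
  ... | inj₂ 1≤0 = begin
    0#                     ≤⟨ *-nonNegative (0≤y-x 1≤0) (0≤y-x 1≤0) ⟩
    (0# - 1#) * (0# - 1#)  ≈⟨ solve 0 ((con (0 , 0) :- one) :* (con (0 , 0) :- one) := one) ≈-refl ⟩
    1#                     ∎

  0<1 : 0# < 1#
  0<1 = 0≤1 , 0≉1

  0<⇒≉0 : ∀ {x} → 0# < x → x ≉ 0#
  0<⇒≉0 (_ , 0≉x) x≈0 = 0≉x (sym x≈0)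

  0<y-x : ∀ {x y} → x < y → 0# < y - x
  0<y-x {x} {y} (x≤y , x≉y) = 0≤y-x x≤y , λ 0≈y-x → x≉y (begin-equality
    x              ≈⟨ +-identityˡ x ⟨
    0# + x         ≈⟨ +-congʳ 0≈y-x ⟩
    (y - x) + x    ≈⟨ solve 2 (λ x y → (y :- x) :+ x := y) ≈-refl x y ⟩
    y              ∎)

  reciprocal : ∀ {x} → 0# < x → ∃[ y ] 0# ≤ y × x * y ≈ 1#
  reciprocal {x} 0<x with inverse x (0<⇒≉0 0<x)
  ... | y , xy≈1 with total 0# y
  ...   | inj₁ 0≤y = y , 0≤y , xy≈1
  ...   | inj₂ y≤0 = contradiction 1≤0 (<⇒≱ 0<1)
    where
    1≤0 : 1# ≤ 0#
    1≤0 = begin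
      1#      ≈⟨ xy≈1 ⟨
      x * y   ≤⟨ *-monoʳ-≤ (proj₁ 0<x) y≤0 ⟩
      x * 0#  ≈⟨ zeroʳ x ⟩
      0#      ∎

  *-cancelˡ-≤ : ∀ {x y z} → 0# < z → z * x ≤ z * y → x ≤ y
  *-cancelˡ-≤ {x} {y} {z} 0<z zx≤zy with reciprocal 0<z
  ... | z⁻¹ , 0≤z⁻¹ , zz⁻¹≈1 = begin
    x              ≈⟨ cancel x ⟨
    z⁻¹ * (z * x)  ≤⟨ *-monoʳ-≤ 0≤z⁻¹ zx≤zy ⟩
    z⁻¹ * (z * y)  ≈⟨ cancel y ⟩
    y              ∎
    where
    cancel : ∀ w → z⁻¹ * (z * w) ≈ w
    cancel w = begin-equality
      z⁻¹ * (z * w)  ≈⟨ solve 3 (λ a b w → a :* (b :* w) := (b :* a) :* w) ≈-refl z⁻¹ z w ⟩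
      z * z⁻¹ * w    ≈⟨ *-congʳ zz⁻¹≈1 ⟩
      1# * w         ≈⟨ *-identityˡ w ⟩
      w              ∎

  *-positive : ∀ {x y} → 0# < x → 0# < y → 0# < x * y
  *-positive {x} {y} 0<x 0<y = ≰⇒> λ xy≤0 →
    <⇒≱ 0<y (*-cancelˡ-≤ 0<x (≤-trans xy≤0 (≤-reflexive (sym (zeroʳ x)))))

  0<≤⇒0< : ∀ {x y} → 0# < x → x ≤ y → 0# < y
  0<≤⇒0< 0<x x≤y = ≰⇒> λ y≤0 → <⇒≱ 0<x (≤-trans x≤y y≤0)

  0≤^ : ∀ {x} n → 0# ≤ x → 0# ≤ x ^ n
  0≤^ zero    0≤x = 0≤1
  0≤^ (suc n) 0≤x = *-nonNegative 0≤x (0≤^ n 0≤x)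

  ^≤1 : ∀ {x} n → 0# ≤ x → x ≤ 1# → x ^ n ≤ 1#
  ^≤1 zero    0≤x x≤1 = ≤-refl
  ^≤1 {x} (suc n) 0≤x x≤1 = begin
    x * x ^ n  ≤⟨ *-mono-≤ (0≤^ n 0≤x) 0≤1 x≤1 (^≤1 n 0≤x x≤1) ⟩
    1# * 1#    ≈⟨ *-identityˡ 1# ⟩
    1#         ∎

  1≤^ : ∀ {x} n → 1# ≤ x → 1# ≤ x ^ n
  1≤^ zero    1≤x = ≤-refl
  1≤^ {x} (suc n) 1≤x = begin
    1#         ≈⟨ *-identityˡ 1# ⟨
    1# * 1#    ≤⟨ *-mono-≤ 0≤1 (≤-trans 0≤1 1≤x) 1≤x (1≤^ n 1≤x) ⟩
    x * x ^ n  ∎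

  ^-antitone : ∀ {x m n} → 0# ≤ x → x ≤ 1# → m ℕ.≤ n → x ^ n ≤ x ^ m
  ^-antitone {n = n} 0≤x x≤1 z≤n = ^≤1 n 0≤x x≤1
  ^-antitone 0≤x x≤1 (s≤s m≤n) = *-monoʳ-≤ 0≤x (^-antitone 0≤x x≤1 m≤n)

  ι-+ : ∀ m n → ι (m ℕ.+ n) ≈ ι m + ι n
  ι-+ = ×-homo-+ 1#

  ι-* : ∀ m n → ι (m ℕ.* n) ≈ ι m * ι n
  ι-* = ×1-homo-*

  ι-1 : ι 1 ≈ 1#
  ι-1 = +-identityʳ 1#

  ι-^ : ∀ m n → ι (m ℕ.^ n) ≈ ι m ^ n
  ι-^ m zero    = ι-1
  ι-^ m (suc n) = trans (ι-* m (m ℕ.^ n)) (*-congˡ (ι-^ m n))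

  0≤ι : ∀ n → 0# ≤ ι n
  0≤ι zero    = ≤-refl
  0≤ι (suc n) = +-nonNegative 0≤1 (0≤ι n)

  ι-mono-≤ : ∀ {m n} → m ℕ.≤ n → ι m ≤ ι n
  ι-mono-≤ {n = n} z≤n = 0≤ι n
  ι-mono-≤ (s≤s m≤n) = +-mono-≤ ≤-refl (ι-mono-≤ m≤n)

  1≤ι : ∀ {n} → 1 ℕ.≤ n → 1# ≤ ι n
  1≤ι 1≤n = ≤-trans (≤-reflexive (sym ι-1)) (ι-mono-≤ 1≤n)

  0<ι : ∀ {n} → 1 ℕ.≤ n → 0# < ι n
  0<ι 1≤n = 0<≤⇒0< 0<1 (1≤ι 1≤n)

  archimedean* : ∀ {x} → 0# < x → ∀ y → ∃[ k ] y ≤ ι k * x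
  archimedean* {x} 0<x y with reciprocal 0<x
  ... | x⁻¹ , 0≤x⁻¹ , xx⁻¹≈1 with archimedean (y * x⁻¹)
  ...   | k , yx⁻¹≤k = k , (begin
    y              ≈⟨ *-identityʳ y ⟨
    y * 1#         ≈⟨ *-congˡ xx⁻¹≈1 ⟨
    y * (x * x⁻¹)  ≈⟨ solve 3 (λ y x z → y :* (x :* z) := (y :* z) :* x) ≈-refl y x x⁻¹ ⟩
    y * x⁻¹ * x    ≤⟨ *-monoˡ-≤ (proj₁ 0<x) yx⁻¹≤k ⟩
    ι k * x        ∎)

  -- Bernoulli's inequality for powers of 1/ρ, multiplied through by `ρ ^ j` so that `ρ` may be 0.
  -- With η = 1 - ρ, the left side drops from j to j + 1 by exactly (1 + j) η² ρ^j.
  bernoulli : ∀ {ρ} → 0# ≤ ρ → ρ ≤ 1# → ∀ j → (1# + ι j * (1# - ρ)) * ρ ^ j ≤ 1#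
  bernoulli {ρ} 0≤ρ ρ≤1 = induct
    where
    η = 1# - ρ

    0≤η : 0# ≤ η
    0≤η = 0≤y-x ρ≤1

    step : ∀ i x → 0# ≤ i → 0# ≤ x → (1# + (1# + i) * η) * (ρ * x) ≤ (1# + i * η) * x
    step i x 0≤i 0≤x = ≤-excess
      (*-nonNegative (*-nonNegative (+-nonNegative 0≤1 0≤i) (*-nonNegative 0≤η 0≤η)) 0≤x)
      (solve 3 (λ r i x → (one :+ (one :+ i) :* (one :- r)) :* (r :* x)
                          :+ (one :+ i) :* ((one :- r) :* (one :- r)) :* x
                          := (one :+ i :* (one :- r)) :* x) ≈-refl ρ i x)

    induct : ∀ j → (1# + ι j * η) * ρ ^ j ≤ 1#
    induct zero    = begin
      (1# + 0# * η) * 1#  ≈⟨ *-identityʳ _ ⟩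
      1# + 0# * η         ≈⟨ +-congˡ (zeroˡ η) ⟩
      1# + 0#             ≈⟨ +-identityʳ 1# ⟩
      1#                  ∎
    induct (suc j) = ≤-trans (step (ι j) (ρ ^ j) (0≤ι j) (0≤^ j 0≤ρ)) (induct j)

  geometric-decay : ∀ {ρ} → 0# ≤ ρ → ρ < 1# → ∀ y → ∃[ j ] y * ρ ^ j ≤ 1#
  geometric-decay {ρ} 0≤ρ ρ<1 y = j , bound
    where
    η = 1# - ρ
    multiple = archimedean* (0<y-x ρ<1) y
    j = proj₁ multiple

    y≤1+jη : y ≤ 1# + ι j * η
    y≤1+jη = begin
      y               ≤⟨ proj₂ multiple ⟩
      ι j * η         ≤⟨ x≤x+d (ι j * η) 0≤1 ⟩
      ι j * η + 1#    ≈⟨ +-comm _ _ ⟩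
      1# + ι j * η    ∎

    bound : y * ρ ^ j ≤ 1#
    bound = ≤-trans (*-monoˡ-≤ (0≤^ j 0≤ρ) y≤1+jη) (bernoulli 0≤ρ (proj₁ ρ<1) j)

-- Spanning trees as minimal connected edge sets.

module Trees {n m : ℕ} (G : Graph n m) where
  open Graph G

  Joins : Fin m → Fin n → Fin n → Set
  Joins e u v = ends e ≡ (u , v) ⊎ ends e ≡ (v , u)

  joins-sym : ∀ {e u v} → Joins e u v → Joins e v u
  joins-sym (inj₁ eq) = inj₂ eq
  joins-sym (inj₂ eq) = inj₁ eq

  joins-unique : ∀ {e u v x y} → Joins e u v → Joins e x y → (u ≡ x × v ≡ y) ⊎ (u ≡ y × v ≡ x)
  joins-unique (inj₁ p) (inj₁ q) with refl ← ≡.trans (≡.sym p) q = inj₁ (refl , refl)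
  joins-unique (inj₁ p) (inj₂ q) with refl ← ≡.trans (≡.sym p) q = inj₂ (refl , refl)
  joins-unique (inj₂ p) (inj₁ q) with refl ← ≡.trans (≡.sym p) q = inj₂ (refl , refl)
  joins-unique (inj₂ p) (inj₂ q) with refl ← ≡.trans (≡.sym p) q = inj₁ (refl , refl)

  adj-sym : ∀ {S u v} → Adj G S u v → Adj G S v u
  adj-sym (e , e∈S , j) = e , e∈S , joins-sym j

  star-sym : ∀ {S u v} → Star (Adj G S) u v → Star (Adj G S) v u
  star-sym = reverse adj-sym

  connected-mono : ∀ {S T} → S ⊆ T → Connected G S → Connected G T
  connected-mono S⊆T conn u v = gmap id (λ (e , e∈S , j) → e , S⊆T e∈S , j) (conn u v)

  -- Each step of an old path that uses `e` is replaced by the detour or by its reverse.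
  removable : ∀ {S e u v} → Connected G S → Joins e u v → Star (Adj G (S ∖ e)) v u →
              Connected G (S ∖ e)
  removable {S} {e} conn joins detour x y = kleisliStar id reroute (conn x y)
    where
    reroute : ∀ {x y} → Adj G S x y → Star (Adj G (S ∖ e)) x y
    reroute (f , f∈S , j) with f Fin.≟ e
    ... | no f≢e = (f , Subset.x∈p∧x≢y⇒x∈p-y f∈S f≢e , j) ◅ ε
    ... | yes refl with joins-unique joins j
    ...   | inj₁ (refl , refl) = star-sym detour
    ...   | inj₂ (refl , refl) = detour

  module _ {S : Subset m} {e : Fin m} {u v : Fin n} (joins : Joins e u v) where

    -- A step avoids `e` as soon as its endpoints are not `u` and `v`: `u ≢ x` excludes one
    -- orientation, the alternative excludes the other.
    other-step : ∀ {x y} → u ≢ x → u ≢ y ⊎ v ≢ x → Adj G S x y → Adj G (S ∖ e) x y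
    other-step {x} {y} u≢x alt (f , f∈S , j) = f , Subset.x∈p∧x≢y⇒x∈p-y f∈S f≢e , j
      where
      impossible : u ≢ y ⊎ v ≢ x → ¬ ((u ≡ x × v ≡ y) ⊎ (u ≡ y × v ≡ x))
      impossible _          (inj₁ (u≡x , _)) = u≢x u≡x
      impossible (inj₁ u≢y) (inj₂ (u≡y , _)) = u≢y u≡y
      impossible (inj₂ v≢x) (inj₂ (_ , v≡x)) = v≢x v≡x

      f≢e : f ≢ e
      f≢e f≡e = impossible alt (joins-unique joins (subst (λ h → Joins h x y) f≡e j))

    return-path : ∀ x xs → All (u ≢_) (x ∷ xs) → All (v ≢_) (x ∷ xs) →
                  Linked (Adj G S) (x ∷ xs ∷ʳ u) → Star (Adj G (S ∖ e)) x u
    return-path x [] (u≢x ∷ _) (v≢x ∷ _) (s ∷ _) = other-step u≢x (inj₂ v≢x) s ◅ ε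
    return-path x (y ∷ ys) (u≢x ∷ u≢) (v≢x ∷ v≢) (s ∷ ss) =
      other-step u≢x (inj₂ v≢x) s ◅ return-path y ys u≢ v≢ ss

  Irredundant : Subset m → Set
  Irredundant S = ∀ {e} → e ∈ S → ¬ Connected G (S ∖ e)

  -- The rest of a cycle is a detour around its first edge, because simplicity of the cycle keeps
  -- the later steps off that edge. A single further vertex would only give the walk u, v, u along
  -- one edge twice; the length condition rules it out.
  irredundant⇒acyclic : ∀ {S} → Connected G S → Irredundant S → Acyclic G S
  irredundant⇒acyclic conn irr u (_ ∷ [] , s≤s () , _)
  irredundant⇒acyclic conn irr u
    (v ∷ w ∷ ws , _ , (u≢v ∷ u≢w ∷ u≢) ∷ (v≢w ∷ v≢) ∷ _ , (e , e∈S , j) ∷ s ∷ ss) =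
    irr e∈S (removable conn j (other-step j u≢v (inj₁ u≢w) s ◅
                               return-path j w ws (u≢w ∷ u≢) (v≢w ∷ v≢) ss))

  irredundantSubset : ∀ S → Acc ℕ._<_ ∣ S ∣ → Connected G S →
                      ∃[ T ] T ⊆ S × Connected G T × Irredundant T
  irredundantSubset S (acc rec) conn
    with Fin.any? (λ e → (e Subset.∈? S) ×-dec connected? G (S ∖ e))
  ... | no none = S , id , conn , λ e∈S conn′ → none (_ , e∈S , conn′)
  ... | yes (e , e∈S , conn′)
    with irredundantSubset (S ∖ e) (rec (Subset.x∈p⇒∣p-x∣<∣p∣ e∈S)) conn′
  ...   | T , T⊆ , rest = T , Subset.p─q⊆p _ _ ∘ T⊆ , rest

  spanningTree : ∀ {S} → Connected G S → ∃[ T ] IsRealizedSpanningTree G S T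
  spanningTree {S} conn with irredundantSubset S (<-wellFounded _) conn
  ... | T , T⊆S , connT , irr = T , T⊆S , connT , irredundant⇒acyclic connT irr

n<2^[1+⌊log₂n⌋] : ∀ n → n ℕ.< 2 ℕ.^ suc ⌊log₂ n ⌋
n<2^[1+⌊log₂n⌋] n = ℕ.≰⇒> λ 2^[1+L]≤n → ℕ.1+n≰n
  (ℕ.≤-trans (ℕ.≤-reflexive (≡.sym (⌊log₂[2^n]⌋≡n (suc ⌊log₂ n ⌋)))) (⌊log₂⌋-mono-≤ 2^[1+L]≤n))

2^≤⇒≤⌊log₂⌋ : ∀ k {n} → 2 ℕ.^ k ℕ.≤ n → k ℕ.≤ ⌊log₂ n ⌋
2^≤⇒≤⌊log₂⌋ k 2^k≤n = subst (ℕ._≤ _) (⌊log₂[2^n]⌋≡n k) (⌊log₂⌋-mono-≤ 2^k≤n)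

-- Majority polling and its reliability.

module UpperBound {c ℓ₁ ℓ₂} (K : ArchimedeanOrderedField c ℓ₁ ℓ₂) where
  open ArchimedeanOrderedField K hiding (refl; zero)
  open OrderedField K
  open Querying K
  open PartialOrderReasoning poset

  -- The verdict goes to a continuation, so that error bounds of successive polls compose. A tie is
  -- read as "No".
  poll : ∀ {m} → Fin m → ℕ → (yeas nays : ℕ) → (Bool → Strategy m) → Strategy m
  poll e zero    y n k = k ((n ℕ.<ᵇ y))
  poll e (suc t) y n k = query e λ a → if a then poll e t (suc y) n k else poll e t y (suc n) k

  pollAll : ∀ {m} l → (Fin l → Fin m) → ℕ → (Vec Bool l → Strategy m) → Strategy m
  pollAll zero    es t k = k []
  pollAll (suc l) es t k =
    poll (es zero) t 0 0 λ b → pollAll l (es ∘ suc) t λ bs → k (b ∷ bs)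

  poll-queries : ∀ {m B} {k : Bool → Strategy m} e t y n →
                 (∀ b → worstCaseQueries (k b) ℕ.≤ B) →
                 worstCaseQueries (poll e t y n k) ℕ.≤ t ℕ.+ B
  poll-queries e zero    y n k≤B = k≤B _
  poll-queries e (suc t) y n k≤B =
    s≤s (ℕ.⊔-lub (poll-queries e t (suc y) n k≤B) (poll-queries e t y (suc n) k≤B))

  pollAll-queries : ∀ {m B} l (es : Fin l → Fin m) t {k : Vec Bool l → Strategy m} →
                    (∀ bs → worstCaseQueries (k bs) ℕ.≤ B) →
                    worstCaseQueries (pollAll l es t k) ℕ.≤ l ℕ.* t ℕ.+ B
  pollAll-queries zero    es t k≤B = k≤B []
  pollAll-queries {B = B} (suc l) es t k≤B = ℕ.≤-trans
    (poll-queries (es zero) t 0 0 λ b → pollAll-queries l (es ∘ suc) t λ bs → k≤B (b ∷ bs))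
    (ℕ.≤-reflexive (≡.sym (ℕ.+-assoc t (l ℕ.* t) B)))

  -- A disconnected `S` can arise only from a wrong majority, and then the output does not matter;
  -- `S` itself is a default.
  candidate : ∀ {n m} (G : Graph n m) {S : Subset m} → Dec (Connected G S) → Subset m
  candidate G     (yes conn) = proj₁ (Trees.spanningTree G conn)
  candidate G {S} (no _)     = S

  candidate-correct : ∀ {n m} (G : Graph n m) {S : Subset m} (conn? : Dec (Connected G S)) →
                      Connected G S → IsRealizedSpanningTree G S (candidate G conn?)
  candidate-correct G (yes conn) _    = proj₂ (Trees.spanningTree G conn)
  candidate-correct G (no ¬conn) conn = contradiction conn ¬conn

  majority : ∀ {n m} → ℕ → Moldgraph n m → Strategy m
  majority t G = pollAll _ id t λ S → output (candidate graph (connected? graph S))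
    where open Moldgraph G

  module Reliability (p : Carrier) (0≤p : 0# ≤ p) (p≤1 : p ≤ 1#) where

    0≤1-p : 0# ≤ 1# - p
    0≤1-p = 0≤y-x p≤1

    module _ {m : ℕ} {ℓ : Level} {P : U.Pred (Subset m) ℓ} (P? : U.Decidable P) (R : Subset m) where

      0≤Pr : ∀ s → 0# ≤ Pr p R P? s
      0≤Pr (output T) with does (P? T)
      ... | true  = 0≤1
      ... | false = ≤-refl
      0≤Pr (query e k) = +-nonNegative (*-nonNegative 0≤1-p (0≤Pr (k _)))
                                       (*-nonNegative 0≤p (0≤Pr (k _)))
      0≤Pr (flip r 0≤r r≤1 k) = +-nonNegative (*-nonNegative 0≤r (0≤Pr (k _)))
                                              (*-nonNegative (0≤y-x r≤1) (0≤Pr (k _)))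

      Pr-output : ∀ {T} → P T → Pr p R P? (output T) ≈ 1#
      Pr-output {T} PT = reflexive (cong (λ b → if b then 1# else 0#) (dec-true (P? T) PT))

      Pr-query : ∀ {e k t} → Vec.lookup R e ≡ t →
                 Pr p R P? (query e k) ≈ (1# - p) * Pr p R P? (k t) + p * Pr p R P? (k (not t))
      Pr-query refl = ≈-refl

      -- With a correct and a wrong answer weighing a and b ≥ 1 = a b, the votes cast so far weigh
      -- at least 1 whenever the majority is wrong, and ρ is the expected weight of one answer.
      module _ {a b ρ : Carrier} (0≤a : 0# ≤ a) (1≤b : 1# ≤ b) (ab≈1 : a * b ≈ 1#)
               (mean : (1# - p) * a + p * b ≈ ρ) where

        weight : Bool → (yeas nays : ℕ) → Carrier
        weight true  y n = a ^ y * b ^ n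
        weight false y n = a ^ n * b ^ y

        0≤b : 0# ≤ b
        0≤b = ≤-trans 0≤1 1≤b

        0≤ρ : 0# ≤ ρ
        0≤ρ = ≤-trans (+-nonNegative (*-nonNegative 0≤1-p 0≤a) (*-nonNegative 0≤p 0≤b))
                      (≤-reflexive mean)

        0≤weight : ∀ t y n → 0# ≤ weight t y n
        0≤weight true  y n = *-nonNegative (0≤^ y 0≤a) (0≤^ n 0≤b)
        0≤weight false y n = *-nonNegative (0≤^ n 0≤a) (0≤^ y 0≤b)

        1≤a^i*b^j : ∀ {i j} → i ℕ.≤ j → 1# ≤ a ^ i * b ^ j
        1≤a^i*b^j {j = j} z≤n = ≤-trans (1≤^ j 1≤b) (≤-reflexive (sym (*-identityˡ _)))
        1≤a^i*b^j (s≤s {i} {j} i≤j) = begin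
          1#                         ≤⟨ 1≤a^i*b^j i≤j ⟩
          a ^ i * b ^ j              ≈⟨ *-identityˡ _ ⟨
          1# * (a ^ i * b ^ j)       ≈⟨ *-congʳ ab≈1 ⟨
          a * b * (a ^ i * b ^ j)    ≈⟨ interchange a b (a ^ i) (b ^ j) ⟩
          a ^ suc i * b ^ suc j      ∎
          where open CommutativeSemigroupProperties *-commutativeSemigroup using (interchange)

        wrong⇒1≤weight : ∀ t y n → (n ℕ.<ᵇ y) ≢ t → 1# ≤ weight t y n
        wrong⇒1≤weight true  y n wrong with n ℕ.<ᵇ y | ℕ.<ᵇ-reflects-< n y
        ... | true  | _        = contradiction refl wrong
        ... | false | ofⁿ n≮y  = 1≤a^i*b^j (ℕ.≮⇒≥ n≮y)
        wrong⇒1≤weight false y n wrong with n ℕ.<ᵇ y | ℕ.<ᵇ-reflects-< n y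
        ... | true  | ofʸ n<y  = 1≤a^i*b^j (ℕ.<⇒≤ n<y)
        ... | false | _        = contradiction refl wrong

        -- One step of the moment induction: averaging over a correct answer, which contributes `a`,
        -- and a wrong one, which contributes `b`, produces one factor `ρ`.
        average : ∀ {v x y r φ} → v ≤ x + r * (a * φ) → v ≤ y + r * (b * φ) →
                  v ≤ ((1# - p) * x + p * y) + ρ * r * φ
        average {v} {x} {y} {r} {φ} ≤x ≤y = begin
          v
            ≈⟨ solve 2 (λ p v → v := (one :- p) :* v :+ p :* v) ≈-refl p v ⟩
          (1# - p) * v + p * v
            ≤⟨ +-mono-≤ (*-monoʳ-≤ 0≤1-p ≤x) (*-monoʳ-≤ 0≤p ≤y) ⟩
          (1# - p) * (x + r * (a * φ)) + p * (y + r * (b * φ))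
            ≈⟨ solve 7 (λ p x y r a b φ →
                 (one :- p) :* (x :+ r :* (a :* φ)) :+ p :* (y :+ r :* (b :* φ))
                 := ((one :- p) :* x :+ p :* y) :+ ((one :- p) :* a :+ p :* b) :* (r :* φ))
                 ≈-refl p x y r a b φ ⟩
          ((1# - p) * x + p * y) + ((1# - p) * a + p * b) * (r * φ)
            ≈⟨ +-congˡ (*-congʳ mean) ⟩
          ((1# - p) * x + p * y) + ρ * (r * φ)
            ≈⟨ +-congˡ (*-assoc ρ r φ) ⟨
          ((1# - p) * x + p * y) + ρ * r * φ ∎

        -- The error term `ρ ^ l * weight t y n` is the expected final weight with `l` votes still
        -- to come, so this is Markov's inequality unrolled along the tree. At a leaf with the wrong
        -- majority, `v` is at most 1 and the weight is at least 1; at the others the continuation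
        -- already reaches `v`.
        poll-reliable : ∀ {v k} e t → Vec.lookup R e ≡ t → v ≤ 1# → v ≤ Pr p R P? (k t) →
                        ∀ l y n → v ≤ Pr p R P? (poll e l y n k) + ρ ^ l * weight t y n
        poll-reliable {v} {k} e t truth v≤1 v≤Pr zero y n with (n ℕ.<ᵇ y) Bool.≟ t
        ... | yes refl = ≤-trans v≤Pr (x≤x+d _ (*-nonNegative 0≤1 (0≤weight ((n ℕ.<ᵇ y)) y n)))
        ... | no wrong = begin
          v                                ≤⟨ v≤1 ⟩
          1#                               ≤⟨ wrong⇒1≤weight t y n wrong ⟩
          weight t y n                     ≈⟨ *-identityˡ _ ⟨
          1# * weight t y n                ≤⟨ x≤x+d _ (0≤Pr (k vote)) ⟩
          1# * weight t y n + Pr p R P? (k vote) ≈⟨ +-comm _ _ ⟩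
          Pr p R P? (k vote) + 1# * weight t y n ∎
          where vote = n ℕ.<ᵇ y
        poll-reliable {v} {k} e true truth v≤1 v≤Pr (suc l) y n = begin
          v  ≤⟨ average (≤-trans (poll-reliable {k = k} e true truth v≤1 v≤Pr l (suc y) n)
                                 (≤-reflexive (+-congˡ (*-congˡ (*-assoc a (a ^ y) (b ^ n))))))
                        (≤-trans (poll-reliable {k = k} e true truth v≤1 v≤Pr l y (suc n))
                                 (≤-reflexive (+-congˡ (*-congˡ (x∙yz≈y∙xz (a ^ y) b (b ^ n)))))) ⟩
          _
            ≈⟨ +-congʳ (Pr-query {k = λ a → if a then poll e l (suc y) n k else poll e l y (suc n) k} truth) ⟨
          _  ∎
          where open CommutativeSemigroupProperties *-commutativeSemigroup using (x∙yz≈y∙xz)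
        poll-reliable {v} {k} e false truth v≤1 v≤Pr (suc l) y n = begin
          v  ≤⟨ average (≤-trans (poll-reliable {k = k} e false truth v≤1 v≤Pr l y (suc n))
                                 (≤-reflexive (+-congˡ (*-congˡ (*-assoc a (a ^ n) (b ^ y))))))
                        (≤-trans (poll-reliable {k = k} e false truth v≤1 v≤Pr l (suc y) n)
                                 (≤-reflexive (+-congˡ (*-congˡ (x∙yz≈y∙xz (a ^ n) b (b ^ y)))))) ⟩
          _
            ≈⟨ +-congʳ (Pr-query {k = λ a → if a then poll e l (suc y) n k else poll e l y (suc n) k} truth) ⟨
          _  ∎
          where open CommutativeSemigroupProperties *-commutativeSemigroup using (x∙yz≈y∙xz)

        -- The union bound: the later polls achieve the target `v` lowered by `ι l * ρ ^ t`, and the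
        -- first poll, started with no votes and hence weight 1, loses one more `ρ ^ t`.
        pollAll-reliable : ∀ {v} l (es : Fin l → Fin m) {k} t → v ≤ 1# →
                           v ≤ Pr p R P? (k (Vec.tabulate (Vec.lookup R ∘ es))) →
                           v ≤ Pr p R P? (pollAll l es t k) + ι l * ρ ^ t
        pollAll-reliable {v} zero es {k} t v≤1 v≤Pr = begin
          v                                      ≤⟨ v≤Pr ⟩
          Pr p R P? (k [])                       ≈⟨ +-identityʳ _ ⟨
          Pr p R P? (k []) + 0#                  ≈⟨ +-congˡ (zeroˡ (ρ ^ t)) ⟨
          Pr p R P? (k []) + 0# * ρ ^ t          ∎
        pollAll-reliable {v} (suc l) es {k} t v≤1 v≤Pr = begin
          v
            ≈⟨ solve 2 (λ v x → v := (v :- x) :+ x) ≈-refl v (ι l * ρ ^ t) ⟩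
          (v - ι l * ρ ^ t) + ι l * ρ ^ t ≤⟨ +-monoˡ-≤ _ first ⟩
          (q + ρ ^ t * (1# * 1#)) + ι l * ρ ^ t
            ≈⟨ solve 3 (λ q r i → (q :+ r :* (one :* one)) :+ i :* r := q :+ (one :+ i) :* r) ≈-refl q (ρ ^ t) (ι l) ⟩
          q + ι (suc l) * ρ ^ t          ∎
          where
          q = Pr p R P? (pollAll (suc l) es t k)
          truth = Vec.lookup R (es zero)

          weight₀ : ∀ t → weight t 0 0 ≡ 1# * 1#
          weight₀ true  = refl
          weight₀ false = refl

          rest : v - ι l * ρ ^ t ≤ Pr p R P? (pollAll l (es ∘ suc) t λ bs → k (truth ∷ bs))
          rest = begin
            v - ι l * ρ ^ t
              ≤⟨ +-monoˡ-≤ _ (pollAll-reliable l (es ∘ suc) {λ bs → k (truth ∷ bs)} t v≤1 v≤Pr) ⟩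
            (q′ + ι l * ρ ^ t) - ι l * ρ ^ t
              ≈⟨ solve 2 (λ q x → (q :+ x) :- x := q) ≈-refl q′ (ι l * ρ ^ t) ⟩
            q′ ∎
            where q′ = Pr p R P? (pollAll l (es ∘ suc) t λ bs → k (truth ∷ bs))

          v-≤1 : v - ι l * ρ ^ t ≤ 1#
          v-≤1 = ≤-trans
            (≤-excess (*-nonNegative (0≤ι l) (0≤^ t 0≤ρ))
                      (solve 2 (λ v x → (v :- x) :+ x := v) ≈-refl v (ι l * ρ ^ t)))
            v≤1

          first : v - ι l * ρ ^ t ≤ q + ρ ^ t * (1# * 1#)
          first = subst (λ w → v - ι l * ρ ^ t ≤ q + ρ ^ t * w) (weight₀ truth)
            (poll-reliable {k = λ b → pollAll l (es ∘ suc) t λ bs → k (b ∷ bs)}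
               (es zero) truth refl v-≤1 rest t 0 0)

        pollAll-output-reliable : ∀ (f : Subset m → Subset m) t → P (f R) →
                                  1# ≤ Pr p R P? (pollAll m id t (output ∘ f)) + ι m * ρ ^ t
        pollAll-output-reliable f t PfR = pollAll-reliable m id {output ∘ f} t ≤-refl
          (subst (λ S → 1# ≤ Pr p R P? (output (f S))) (≡.sym (Vec.tabulate∘lookup R))
                 (≤-reflexive (sym (Pr-output PfR))))

2^n*2^n≡4^n : ∀ n → 2 ℕ.^ n ℕ.* 2 ℕ.^ n ≡ 4 ℕ.^ n
2^n*2^n≡4^n n = begin
  2 ℕ.^ n ℕ.* 2 ℕ.^ n   ≡⟨ ℕ.^-distribˡ-+-* 2 n n ⟨
  2 ℕ.^ (n ℕ.+ n)       ≡⟨ cong (λ k → 2 ℕ.^ (n ℕ.+ k)) (ℕ.+-identityʳ n) ⟨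
  2 ℕ.^ (2 ℕ.* n)       ≡⟨ ℕ.^-*-assoc 2 2 n ⟨
  4 ℕ.^ n               ∎
  where open ≡.≡-Reasoning

-- The logarithm is at least 1 here, so it absorbs the added 1 at the price of a factor 2. The `0`
-- is the cost of the final output.
m*j[1+L]≤2j[mL] : ∀ m j → 2 ℕ.≤ m →
                  m ℕ.* (j ℕ.* suc ⌊log₂ m ⌋) ℕ.+ 0 ℕ.≤ (2 ℕ.* j) ℕ.* (m ℕ.* ⌊log₂ m ⌋)
m*j[1+L]≤2j[mL] m j 2≤m = begin
  m ℕ.* (j ℕ.* suc L) ℕ.+ 0     ≡⟨ ℕ.+-identityʳ _ ⟩
  m ℕ.* (j ℕ.* (1 ℕ.+ L))       ≤⟨ ℕ.*-monoʳ-≤ m (ℕ.*-monoʳ-≤ j (ℕ.+-monoˡ-≤ L (2^≤⇒≤⌊log₂⌋ 1 2≤m))) ⟩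
  m ℕ.* (j ℕ.* (L ℕ.+ L))
    ≡⟨ solve 3 (λ m j L → m :* (j :* (L :+ L)) := con 2 :* j :* (m :* L)) refl m j L ⟩
  (2 ℕ.* j) ℕ.* (m ℕ.* L)       ∎
  where
  L = ⌊log₂ m ⌋
  open ℕ.≤-Reasoning
  open ℕSolver.+-*-Solver

-- The upper bound: choice of weights and of the number of votes.

module _ {c ℓ₁ ℓ₂} (K : ArchimedeanOrderedField c ℓ₁ ℓ₂) where
  open ArchimedeanOrderedField K hiding (refl; zero)

  module UpperBoundTheorem (p : Carrier) (0≤p : 0# ≤ p) (p+p<1 : p + p < 1#) where

    open OrderedField K
    open Querying K
    open UpperBound K
    open PartialOrderReasoning poset

    gap : Carrier
    gap = 1# - (p + p)

    0<gap : 0# < gap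
    0<gap = 0<y-x p+p<1

    p≤1 : p ≤ 1#
    p≤1 = ≤-trans (x≤x+d p 0≤p) (proj₁ p+p<1)

    0<1-p : 0# < 1# - p
    0<1-p = 0<≤⇒0< 0<gap (≤-excess 0≤p (solve 1 (λ p → (one :- (p :+ p)) :+ p := one :- p) ≈-refl p))

    -- Any weight slightly above 1 would give decay; this one makes `1# - ρ` explicit.
    b : Carrier
    b = 1# + gap

    1≤b : 1# ≤ b
    1≤b = x≤x+d 1# (proj₁ 0<gap)

    b⁻¹ : ∃[ a ] 0# ≤ a × b * a ≈ 1#
    b⁻¹ = reciprocal (0<≤⇒0< 0<1 1≤b)

    a : Carrier
    a = proj₁ b⁻¹

    0≤a : 0# ≤ a
    0≤a = proj₁ (proj₂ b⁻¹)

    ab≈1 : a * b ≈ 1#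
    ab≈1 = trans (*-comm a b) (proj₂ (proj₂ b⁻¹))

    ρ : Carrier
    ρ = (1# - p) * a + p * b

    0≤ρ : 0# ≤ ρ
    0≤ρ = +-nonNegative (*-nonNegative (proj₁ 0<1-p) 0≤a) (*-nonNegative 0≤p (≤-trans 0≤1 1≤b))

    -- Multiplying by `b` eliminates its inverse `a`: (1 - ρ) b equals gap² (1 - p), which is
    -- positive.
    ρ<1 : ρ < 1#
    ρ<1 = ≰⇒> λ 1≤ρ → <⇒≱ (*-positive (*-positive 0<gap 0<gap) 0<1-p) (begin
      gap * gap * (1# - p)
        ≈⟨ solve 1 (λ p → let e = one :- (p :+ p); b = one :+ e in
                          e :* e :* (one :- p) := b :- ((one :- p) :* one :+ p :* b :* b)) ≈-refl p ⟩
      b - ((1# - p) * 1# + p * b * b)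
        ≈⟨ +-congˡ (-‿cong (+-congʳ (*-congˡ ab≈1))) ⟨
      b - ((1# - p) * (a * b) + p * b * b)
        ≈⟨ solve 3 (λ p a b → b :- ((one :- p) :* (a :* b) :+ p :* b :* b)
                              := (one :- ((one :- p) :* a :+ p :* b)) :* b) ≈-refl p a b ⟩
      (1# - ρ) * b
        ≤⟨ *-monoˡ-≤ (≤-trans 0≤1 1≤b) (+-mono-≤ 1≤ρ (≤-refl { - ρ})) ⟩
      (ρ - ρ) * b
        ≈⟨ solve 2 (λ r b → (r :- r) :* b := con (0 , 0)) ≈-refl ρ b ⟩
      0# ∎)

    -- The factor 4 makes the error of one majority at most 4^(-(1 + ⌊log₂ m⌋)), hence at most 1/m².
    -- The union bound over m edges then still leaves 1/m, which tends to 0; a factor 2 would only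
    -- leave a constant.
    decay : ∃[ j ] ι 4 * ρ ^ j ≤ 1#
    decay = geometric-decay 0≤ρ ρ<1 (ι 4)

    j : ℕ
    j = proj₁ decay

    votes : ℕ → ℕ
    votes m = j ℕ.* suc ⌊log₂ m ⌋

    algorithm : Algorithm
    algorithm {m = m} = majority (votes m)

    m*m≤4^ : ∀ m → m ℕ.* m ℕ.≤ 4 ℕ.^ suc ⌊log₂ m ⌋
    m*m≤4^ m = ℕ.≤-trans (ℕ.*-mono-≤ m≤2^ m≤2^)
                         (ℕ.≤-reflexive (2^n*2^n≡4^n (suc ⌊log₂ m ⌋)))
      where
      m≤2^ = ℕ.<⇒≤ (n<2^[1+⌊log₂n⌋] m)

    m²ρ^votes≤1 : ∀ m → ι m * (ι m * ρ ^ votes m) ≤ 1#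
    m²ρ^votes≤1 m = begin
      ι m * (ι m * ρ ^ votes m)                        ≈⟨ *-assoc _ _ _ ⟨
      ι m * ι m * ρ ^ votes m                          ≈⟨ *-congʳ (ι-* m m) ⟨
      ι (m ℕ.* m) * ρ ^ votes m
        ≤⟨ *-monoˡ-≤ (0≤^ (votes m) 0≤ρ) (ι-mono-≤ (m*m≤4^ m)) ⟩
      ι (4 ℕ.^ l) * ρ ^ votes m                        ≈⟨ *-cong (ι-^ 4 l) (sym (^-assocʳ ρ j l)) ⟩
      ι 4 ^ l * (ρ ^ j) ^ l                            ≈⟨ ^-distrib-* (ι 4) (ρ ^ j) l ⟨
      (ι 4 * ρ ^ j) ^ l
        ≤⟨ ^≤1 l (*-nonNegative (0≤ι 4) (0≤^ j 0≤ρ)) (proj₂ decay) ⟩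
      1#                                               ∎
      where l = suc ⌊log₂ m ⌋

    open Reliability p 0≤p p≤1

    majority-fails-rarely : ∀ {n m} t (G : Moldgraph n m) R → Connected (Moldgraph.graph G) R →
                            1# ≤ successProbability p G R (majority t G) + ι m * ρ ^ t
    majority-fails-rarely t G R conn =
      pollAll-output-reliable (isRealizedSpanningTree? graph R) R 0≤a 1≤b ab≈1 ≈-refl
        (λ S → candidate graph (connected? graph S)) t
        (candidate-correct graph (connected? graph R) conn)
      where open Moldgraph G

    succeeds : SucceedsWithHighProbability p algorithm
    -- The failure probability is at most 1/m, which is below `δ` once `ι m₀ * δ` reaches 1. The
    -- successor makes m visibly positive, so that it can be cancelled in `small`.
    succeeds δ 0<δ = suc m₀ , λ m m₀<m G R conn → begin
      1# - δ
        ≤⟨ +-monoˡ-≤ (- δ) (majority-fails-rarely (votes m) G R conn) ⟩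
      (successProbability p G R (algorithm G) + ι m * ρ ^ votes m) - δ
        ≤⟨ ≤-excess (0≤y-x (small m m₀<m))
             (solve 3 (λ s x d → ((s :+ x) :- d) :+ (d :- x) := s) ≈-refl _ (ι m * ρ ^ votes m) δ) ⟩
      successProbability p G R (algorithm G) ∎
      where
      m₀ = proj₁ (archimedean* 0<δ 1#)

      small : ∀ m → m₀ ℕ.< m → ι m * ρ ^ votes m ≤ δ
      small m m₀<m = *-cancelˡ-≤ (0<ι (ℕ.≤-trans (s≤s z≤n) m₀<m)) (begin
        ι m * (ι m * ρ ^ votes m)  ≤⟨ m²ρ^votes≤1 m ⟩
        1#                         ≤⟨ proj₂ (archimedean* 0<δ 1#) ⟩
        ι m₀ * δ                   ≤⟨ *-monoˡ-≤ (proj₁ 0<δ) (ι-mono-≤ (ℕ.<⇒≤ m₀<m)) ⟩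
        ι m * δ                    ∎)

    query-bound : ∀ {n} m → 2 ℕ.≤ m → (G : Moldgraph n m) →
                  worstCaseQueries (algorithm G) ℕ.≤ (2 ℕ.* j) ℕ.* (m ℕ.* ⌊log₂ m ⌋)
    query-bound m 2≤m G = ℕ.≤-trans (pollAll-queries m id (votes m) (λ _ → z≤n)) (m*j[1+L]≤2j[mL] m j 2≤m)

-- Guessing hidden bits from noisy answers.

module _ {c ℓ₁ ℓ₂} (K : ArchimedeanOrderedField c ℓ₁ ℓ₂) where
  open ArchimedeanOrderedField K hiding (refl; zero)

  module Guessing (p : Carrier) (0≤p : 0# ≤ p) (p+p≤1 : p + p ≤ 1#) where

    open OrderedField K
    open Querying K
    open PartialOrderReasoning poset

    p≤1 : p ≤ 1#
    p≤1 = ≤-trans (x≤x+d p 0≤p) p+p≤1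

    p≤1-p : p ≤ 1# - p
    p≤1-p = begin
      p            ≈⟨ solve 1 (λ p → p := (p :+ p) :- p) ≈-refl p ⟩
      (p + p) - p  ≤⟨ +-monoˡ-≤ (- p) p+p≤1 ⟩
      1# - p       ∎

    1-p≤1 : 1# - p ≤ 1#
    1-p≤1 = ≤-excess 0≤p (solve 1 (λ p → (one :- p) :+ p := one) ≈-refl p)

    ∑ : ∀ N → (Vec Bool N → Carrier) → Carrier
    ∑ zero    f = f []
    ∑ (suc N) f = ∑ N (f ∘ (true ∷_)) + ∑ N (f ∘ (false ∷_))

    ∑-mono : ∀ N {f g} → (∀ x → f x ≤ g x) → ∑ N f ≤ ∑ N g
    ∑-mono zero    f≤g = f≤g []
    ∑-mono (suc N) f≤g = +-mono-≤ (∑-mono N (f≤g ∘ (true ∷_))) (∑-mono N (f≤g ∘ (false ∷_)))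

    ∑-cong : ∀ N {f g} → (∀ x → f x ≈ g x) → ∑ N f ≈ ∑ N g
    ∑-cong zero    f≈g = f≈g []
    ∑-cong (suc N) f≈g = +-cong (∑-cong N (f≈g ∘ (true ∷_))) (∑-cong N (f≈g ∘ (false ∷_)))

    ∑-linear : ∀ N r s f g → ∑ N (λ x → r * f x + s * g x) ≈ r * ∑ N f + s * ∑ N g
    ∑-linear zero    r s f g = ≈-refl
    ∑-linear (suc N) r s f g = begin-equality
      _ ≈⟨ +-cong (∑-linear N r s (f ∘ (true ∷_)) (g ∘ (true ∷_)))
                  (∑-linear N r s (f ∘ (false ∷_)) (g ∘ (false ∷_))) ⟩
      (r * f₁ + s * g₁) + (r * f₀ + s * g₀)
        ≈⟨ solve 6 (λ r s f₁ f₀ g₁ g₀ → (r :* f₁ :+ s :* g₁) :+ (r :* f₀ :+ s :* g₀)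
                                        := r :* (f₁ :+ f₀) :+ s :* (g₁ :+ g₀)) ≈-refl r s f₁ f₀ g₁ g₀ ⟩
      r * (f₁ + f₀) + s * (g₁ + g₀) ∎
      where
      f₁ = ∑ N (f ∘ (true ∷_))
      f₀ = ∑ N (f ∘ (false ∷_))
      g₁ = ∑ N (g ∘ (true ∷_))
      g₀ = ∑ N (g ∘ (false ∷_))

    ∑-scale : ∀ N r f → ∑ N (λ x → r * f x) ≈ r * ∑ N f
    ∑-scale zero    r f = ≈-refl
    ∑-scale (suc N) r f = trans (+-cong (∑-scale N r (f ∘ (true ∷_))) (∑-scale N r (f ∘ (false ∷_))))
                                (sym (distribˡ r _ _))

    ∑-+ : ∀ N f g → ∑ N (λ x → f x + g x) ≈ ∑ N f + ∑ N g
    ∑-+ zero    f g = ≈-refl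
    ∑-+ (suc N) f g = trans (+-cong (∑-+ N (f ∘ (true ∷_)) (g ∘ (true ∷_)))
                                    (∑-+ N (f ∘ (false ∷_)) (g ∘ (false ∷_))))
                            (interchange _ _ _ _)
      where open CommutativeSemigroupProperties +-commutativeSemigroup using (interchange)

    ∑-nonPositive : ∀ N {f} → (∀ x → f x ≤ 0#) → ∑ N f ≤ 0#
    ∑-nonPositive zero    f≤0 = f≤0 []
    ∑-nonPositive (suc N) f≤0 = ≤-trans
      (+-mono-≤ (∑-nonPositive N (f≤0 ∘ (true ∷_))) (∑-nonPositive N (f≤0 ∘ (false ∷_))))
      (≤-reflexive (+-identityʳ 0#))

    ∑≤single : ∀ N {f} y → (∀ x → x ≢ y → f x ≤ 0#) → ∑ N f ≤ f y
    ∑≤single zero    [] f≤0 = ≤-refl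
    ∑≤single (suc N) (true ∷ y) f≤0 = ≤-trans
      (+-mono-≤ (∑≤single N y (λ x x≢y → f≤0 (true ∷ x) (x≢y ∘ Vec.∷-injectiveʳ)))
                (∑-nonPositive N (λ x → f≤0 (false ∷ x) (λ ()))))
      (≤-reflexive (+-identityʳ _))
    ∑≤single (suc N) (false ∷ y) f≤0 = ≤-trans
      (+-mono-≤ (∑-nonPositive N (λ x → f≤0 (true ∷ x) (λ ())))
                (∑≤single N y (λ x x≢y → f≤0 (false ∷ x) (x≢y ∘ Vec.∷-injectiveʳ))))
      (≤-reflexive (+-identityˡ _))

    -- The unnormalised posterior weights of a hidden bit after count noisy answers about it.
    record Belief : Set (c ⊔ ℓ₂) where
      field
        weight   : Bool → Carrier
        count    : ℕ
        0≤weight : ∀ y → 0# ≤ weight y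
        balanced : ∀ y → p ^ count * weight (not y) ≤ weight y

    open Belief

    likelihood : (answer truth : Bool) → Carrier
    likelihood true  true  = 1# - p
    likelihood true  false = p
    likelihood false true  = p
    likelihood false false = 1# - p

    p≤likelihood : ∀ a t → p ≤ likelihood a t
    p≤likelihood true  true  = p≤1-p
    p≤likelihood true  false = ≤-refl
    p≤likelihood false true  = ≤-refl
    p≤likelihood false false = p≤1-p

    likelihood≤1 : ∀ a t → likelihood a t ≤ 1#
    likelihood≤1 true  true  = 1-p≤1
    likelihood≤1 true  false = p≤1
    likelihood≤1 false true  = p≤1
    likelihood≤1 false false = 1-p≤1

    likelihood-total : ∀ t → likelihood true t + likelihood false t ≈ 1#
    likelihood-total true  = solve 1 (λ p → (one :- p) :+ p := one) ≈-refl p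
    likelihood-total false = solve 1 (λ p → p :+ (one :- p) := one) ≈-refl p

    -- `f` turns the hidden bit into the truth about the queried edge. The answer multiplies each
    -- weight by a factor between `p` and 1, so their ratio worsens by at most a factor `p`,
    -- whatever `f` is.
    observe : (Bool → Bool) → (answer : Bool) → Belief → Belief
    observe f a h = record
      { weight   = λ y → likelihood a (f y) * weight h y
      ; count    = suc (count h)
      ; 0≤weight = λ y → *-nonNegative (≤-trans 0≤p (p≤likelihood a (f y))) (0≤weight h y)
      ; balanced = λ y → begin
          p * p ^ count h * (likelihood a (f (not y)) * weight h (not y))
            ≈⟨ interchange p (p ^ count h) _ _ ⟩
          p * likelihood a (f (not y)) * (p ^ count h * weight h (not y))
            ≤⟨ *-mono-≤ (*-nonNegative (0≤^ (count h) 0≤p) (0≤weight h (not y)))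
                        (≤-trans 0≤p (p≤likelihood a (f y)))
                        (≤-trans (*-monoʳ-≤ 0≤p (likelihood≤1 a (f (not y))))
                                 (≤-trans (≤-reflexive (*-identityʳ p)) (p≤likelihood a (f y))))
                        (balanced h y) ⟩
          likelihood a (f y) * weight h y ∎
      }
      where open CommutativeSemigroupProperties *-commutativeSemigroup using (interchange)

    joint : ∀ {N} → Vec Belief N → Vec Bool N → Carrier
    joint []       []       = 1#
    joint (h ∷ hs) (y ∷ ys) = weight h y * joint hs ys

    mass : ∀ {N} → Vec Belief N → Carrier
    mass []       = 1#
    mass (h ∷ hs) = (weight h true + weight h false) * mass hs

    totalCount : ∀ {N} → Vec Belief N → ℕ
    totalCount []       = 0
    totalCount (h ∷ hs) = count h ℕ.+ totalCount hs

    doubt : ∀ {N} → Vec Belief N → Carrier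
    doubt []       = 0#
    doubt (h ∷ hs) = p ^ count h + doubt hs

    observeAt : ∀ {N} → Fin N → (Bool → Bool) → Bool → Vec Belief N → Vec Belief N
    observeAt i f a hs = Vec.updateAt hs i (observe f a)

    0≤joint : ∀ {N} (hs : Vec Belief N) x → 0# ≤ joint hs x
    0≤joint []       []       = 0≤1
    0≤joint (h ∷ hs) (y ∷ ys) = *-nonNegative (0≤weight h y) (0≤joint hs ys)

    0≤doubt : ∀ {N} (hs : Vec Belief N) → 0# ≤ doubt hs
    0≤doubt []       = ≤-refl
    0≤doubt (h ∷ hs) = +-nonNegative (0≤^ (count h) 0≤p) (0≤doubt hs)

    joint-observeAt : ∀ {N} (hs : Vec Belief N) i f a x →
                      joint (observeAt i f a hs) x ≈ joint hs x * likelihood a (f (Vec.lookup x i))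
    joint-observeAt (h ∷ hs) zero f a (y ∷ ys) =
      solve 3 (λ l w j → l :* w :* j := w :* j :* l) ≈-refl (likelihood a (f y)) (weight h y) (joint hs ys)
    joint-observeAt (h ∷ hs) (suc i) f a (y ∷ ys) =
      trans (*-congˡ (joint-observeAt hs i f a ys)) (sym (*-assoc _ _ _))

    -- Total probability: under each value of the bit, the likelihoods of the two answers add up to
    -- 1.
    mass-observeAt : ∀ {N} (hs : Vec Belief N) i f →
                     mass (observeAt i f true hs) + mass (observeAt i f false hs) ≈ mass hs
    mass-observeAt (h ∷ hs) zero f = begin-equality
      (l₁₁ * w₁ + l₁₀ * w₀) * M + (l₀₁ * w₁ + l₀₀ * w₀) * M
        ≈⟨ solve 7 (λ a b c d w₁ w₀ M → (a :* w₁ :+ b :* w₀) :* M :+ (c :* w₁ :+ d :* w₀) :* M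
                                        := ((a :+ c) :* w₁ :+ (b :+ d) :* w₀) :* M)
                 ≈-refl l₁₁ l₁₀ l₀₁ l₀₀ w₁ w₀ M ⟩
      ((l₁₁ + l₀₁) * w₁ + (l₁₀ + l₀₀) * w₀) * M
        ≈⟨ *-congʳ (+-cong (*-congʳ (likelihood-total (f true))) (*-congʳ (likelihood-total (f false)))) ⟩
      (1# * w₁ + 1# * w₀) * M
        ≈⟨ *-congʳ (+-cong (*-identityˡ w₁) (*-identityˡ w₀)) ⟩
      (w₁ + w₀) * M ∎
      where
      l₁₁ = likelihood true (f true)
      l₁₀ = likelihood true (f false)
      l₀₁ = likelihood false (f true)
      l₀₀ = likelihood false (f false)
      w₁ = weight h true
      w₀ = weight h false
      M = mass hs
    mass-observeAt (h ∷ hs) (suc i) f = trans (sym (distribˡ _ _ _)) (*-congˡ (mass-observeAt hs i f))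

    totalCount-observeAt : ∀ {N} (hs : Vec Belief N) i f a →
                           totalCount (observeAt i f a hs) ≡ suc (totalCount hs)
    totalCount-observeAt (h ∷ hs) zero    f a = refl
    totalCount-observeAt (h ∷ hs) (suc i) f a =
      ≡.trans (cong (count h ℕ.+_) (totalCount-observeAt hs i f a)) (ℕ.+-suc (count h) _)

    ∑-joint : ∀ {N} (hs : Vec Belief N) → ∑ N (joint hs) ≈ mass hs
    ∑-joint []       = ≈-refl
    ∑-joint (h ∷ hs) = begin-equality
      _ ≈⟨ +-cong (∑-scale _ (weight h true) (joint hs)) (∑-scale _ (weight h false) (joint hs)) ⟩
      _ ≈⟨ distribʳ _ _ _ ⟨
      _ ≈⟨ *-congˡ (∑-joint hs) ⟩
      (weight h true + weight h false) * mass hs ∎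

    scaled-weight≤ : ∀ h y → (1# + p ^ count h) * weight h y ≤ weight h true + weight h false
    scaled-weight≤ h true  = ≤-trans (≤-reflexive (trans (distribʳ _ _ _) (+-congʳ (*-identityˡ _))))
                                     (+-mono-≤ ≤-refl (balanced h false))
    scaled-weight≤ h false = ≤-trans
      (≤-reflexive (trans (distribʳ _ _ _) (trans (+-comm _ _) (+-congˡ (*-identityˡ _)))))
      (+-mono-≤ (balanced h true) ≤-refl)

    -- The product of the factors 1 + p^c over the bits dominates 1 plus their sum; the slack is the
    -- cross term `x * d`.
    guess≤mass : ∀ {N} (hs : Vec Belief N) y → (1# + doubt hs) * joint hs y ≤ mass hs
    guess≤mass []       []       = ≤-reflexive (trans (*-identityʳ _) (+-identityʳ 1#))
    guess≤mass (h ∷ hs) (y ∷ ys) = begin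
      (1# + (x + d)) * (w * j)
        ≤⟨ ≤-excess (*-nonNegative (*-nonNegative 0≤x (0≤doubt hs)) (*-nonNegative (0≤weight h y) (0≤joint hs ys)))
             (solve 4 (λ x d w j → (one :+ (x :+ d)) :* (w :* j) :+ x :* d :* (w :* j)
                                   := ((one :+ x) :* w) :* ((one :+ d) :* j)) ≈-refl x d w j) ⟩
      ((1# + x) * w) * ((1# + d) * j)
        ≤⟨ *-mono-≤ (*-nonNegative (+-nonNegative 0≤1 (0≤doubt hs)) (0≤joint hs ys))
                    (+-nonNegative (0≤weight h true) (0≤weight h false))
                    (scaled-weight≤ h y) (guess≤mass hs ys) ⟩
      (weight h true + weight h false) * mass hs ∎
      where
      x = p ^ count h
      d = doubt hs
      w = weight h y
      j = joint hs ys

      0≤x : 0# ≤ x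
      0≤x = 0≤^ (count h) 0≤p

    trivial : Belief
    trivial = record
      { weight   = λ _ → 1#
      ; count    = 0
      ; 0≤weight = λ _ → 0≤1
      ; balanced = λ _ → ≤-reflexive (*-identityˡ 1#)
      }

    prior : ∀ N → Vec Belief N
    prior zero    = []
    prior (suc N) = trivial ∷ prior N

    totalCount-prior : ∀ N → totalCount (prior N) ≡ 0
    totalCount-prior zero    = refl
    totalCount-prior (suc N) = totalCount-prior N

    0<mass-prior : ∀ N → 0# < mass (prior N)
    0<mass-prior zero    = 0<1
    0<mass-prior (suc N) = *-positive (0<≤⇒0< 0<1 (x≤x+d 1# 0≤1)) (0<mass-prior N)

    -- The graph enters only through two facts: the status of each edge depends on one hidden bit,
    -- and a successful output determines all bits.
    module _ {m N : ℕ} {ℓ : Level} (R : Vec Bool N → Subset m)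
             (observed : ∀ e → ∃[ i ] Σ[ f ∈ (Bool → Bool) ] ∀ x → Vec.lookup (R x) e ≡ f (Vec.lookup x i))
             {P : Vec Bool N → U.Pred (Subset m) ℓ} (P? : ∀ x → U.Decidable (P x))
             (decode : Subset m → Vec Bool N) (decode-correct : ∀ x T → P x T → decode T ≡ x)
             {β : Carrier} {q : ℕ} (0≤β : 0# ≤ β)
             (β≤doubt : ∀ (hs : Vec Belief N) → totalCount hs ℕ.≤ q → β ≤ doubt hs)
      where

      success : Strategy m → Vec Bool N → Carrier
      success s x = Pr p (R x) (P? x) s

      0≤1+β : 0# ≤ 1# + β
      0≤1+β = +-nonNegative 0≤1 0≤β

      success-query : ∀ e k x {t} → Vec.lookup (R x) e ≡ t →
                      success (query e k) x ≈
                      likelihood true t * success (k true) x + likelihood false t * success (k false) x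
      success-query e k x {true}  eq rewrite eq = ≈-refl
      success-query e k x {false} eq rewrite eq = +-comm _ _

      split : ∀ {J A B X Y M} → (1# + β) * X ≤ A → (1# + β) * Y ≤ B → J ≈ X + Y → A + B ≈ M → (1# + β) * J ≤ M
      split {J} {A} {B} {X} {Y} {M} X≤A Y≤B J≈X+Y A+B≈M = begin
        (1# + β) * J                   ≈⟨ *-congˡ J≈X+Y ⟩
        (1# + β) * (X + Y)             ≈⟨ distribˡ _ X Y ⟩
        (1# + β) * X + (1# + β) * Y    ≤⟨ +-mono-≤ X≤A Y≤B ⟩
        A + B                          ≈⟨ A+B≈M ⟩
        M                              ∎

      scale : ∀ {r A X} → 0# ≤ r → (1# + β) * X ≤ A → (1# + β) * (r * X) ≤ r * A
      scale {r} {A} {X} 0≤r X≤A = ≤-trans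
        (≤-reflexive (solve 3 (λ b r x → b :* (r :* x) := r :* (b :* x)) ≈-refl (1# + β) r X))
        (*-monoʳ-≤ 0≤r X≤A)

      -- One output can be right for only one hidden vector, the one it decodes to.
      output-bound : ∀ T (hs : Vec Belief N) → ∑ N (λ x → joint hs x * success (output T) x) ≤ joint hs (decode T)
      output-bound T hs = ≤-trans
        (∑≤single N (decode T) λ x x≢ → ≤-reflexive
          (trans (*-congˡ (wrong x (x≢ ∘ ≡.sym ∘ decode-correct x T))) (zeroʳ _)))
        (≤-trans (*-monoʳ-≤ (0≤joint hs (decode T)) indicator≤1) (≤-reflexive (*-identityʳ _)))
        where
        wrong : ∀ x → ¬ P x T → success (output T) x ≈ 0#
        wrong x ¬PxT = reflexive (cong (λ b → if b then 1# else 0#) (dec-false (P? x T) ¬PxT))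

        indicator≤1 : success (output T) (decode T) ≤ 1#
        indicator≤1 with does (P? (decode T) T)
        ... | true  = ≤-refl
        ... | false = 0≤1

      -- The sum is the joint weight of reaching this node with belief `hs` and then succeeding, and
      -- `mass hs` is the weight of reaching it. Both sides add up over the answers to a query and
      -- mix linearly over a coin, so only the leaves need an argument. `totalCount hs` records the
      -- queries already spent from the budget `q`.
      success-bound : ∀ s (hs : Vec Belief N) → totalCount hs ℕ.+ worstCaseQueries s ℕ.≤ q →
                      (1# + β) * ∑ N (λ x → joint hs x * success s x) ≤ mass hs
      success-bound (output T) hs ≤q = begin
        (1# + β) * ∑ N (λ x → joint hs x * success (output T) x)
          ≤⟨ *-monoʳ-≤ 0≤1+β (output-bound T hs) ⟩
        (1# + β) * joint hs (decode T)
          ≤⟨ *-monoˡ-≤ (0≤joint hs (decode T)) (+-mono-≤ ≤-refl (β≤doubt hs (ℕ.m+n≤o⇒m≤o _ ≤q))) ⟩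
        (1# + doubt hs) * joint hs (decode T)
          ≤⟨ guess≤mass hs (decode T) ⟩
        mass hs ∎
      success-bound (query e k) hs ≤q =
        split (success-bound (k true) hs₁ (budget true (ℕ.m≤m⊔n _ _)))
              (success-bound (k false) hs₀ (budget false (ℕ.m≤n⊔m (worstCaseQueries (k true)) _)))
              (trans (∑-cong N pointwise) (∑-+ N _ _))
              (mass-observeAt hs i f)
        where
        i = proj₁ (observed e)
        f = proj₁ (proj₂ (observed e))
        hs₁ = observeAt i f true hs
        hs₀ = observeAt i f false hs

        budget : ∀ a → worstCaseQueries (k a) ℕ.≤ worstCaseQueries (k true) ℕ.⊔ worstCaseQueries (k false) →
                 totalCount (observeAt i f a hs) ℕ.+ worstCaseQueries (k a) ℕ.≤ q
        budget a k≤ = ℕ.≤-trans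
          (ℕ.≤-reflexive (≡.trans (cong (ℕ._+ _) (totalCount-observeAt hs i f a)) (≡.sym (ℕ.+-suc _ _))))
          (ℕ.≤-trans (ℕ.+-monoʳ-≤ (totalCount hs) (s≤s k≤)) ≤q)

        rearrange : ∀ j l₁ s₁ l₀ s₀ → j * (l₁ * s₁ + l₀ * s₀) ≈ j * l₁ * s₁ + j * l₀ * s₀
        rearrange = solve 5 (λ j l₁ s₁ l₀ s₀ → j :* (l₁ :* s₁ :+ l₀ :* s₀)
                                               := j :* l₁ :* s₁ :+ j :* l₀ :* s₀) ≈-refl

        pointwise : ∀ x → joint hs x * success (query e k) x ≈
                          joint hs₁ x * success (k true) x + joint hs₀ x * success (k false) x
        pointwise x = begin-equality
          _ ≈⟨ *-congˡ (success-query e k x (proj₂ (proj₂ (observed e)) x)) ⟩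
          _ ≈⟨ rearrange _ _ _ _ _ ⟩
          _
            ≈⟨ +-cong (*-congʳ (joint-observeAt hs i f true x)) (*-congʳ (joint-observeAt hs i f false x)) ⟨
          _ ∎
      success-bound (flip r 0≤r r≤1 k) hs ≤q =
        split (scale 0≤r (success-bound (k true) hs (budget (ℕ.m≤m⊔n _ _))))
              (scale (0≤y-x r≤1) (success-bound (k false) hs (budget (ℕ.m≤n⊔m (worstCaseQueries (k true)) _))))
              (trans (∑-cong N λ x → rearrange (joint hs x) _ _ _ _) (∑-linear N r (1# - r) _ _))
              (solve 2 (λ r M → r :* M :+ (one :- r) :* M := M) ≈-refl r (mass hs))
        where
        budget : ∀ {w} → w ℕ.≤ worstCaseQueries (k true) ℕ.⊔ worstCaseQueries (k false) →
                 totalCount hs ℕ.+ w ℕ.≤ q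
        budget w≤ = ℕ.≤-trans (ℕ.+-monoʳ-≤ (totalCount hs) w≤) ≤q

        rearrange : ∀ j r s t u → j * (r * s + t * u) ≈ r * (j * s) + t * (j * u)
        rearrange = solve 5 (λ j r s t u → j :* (r :* s :+ t :* u) := r :* (j :* s) :+ t :* (j :* u)) ≈-refl

      -- The easy direction of Yao's principle: a guarantee for every hidden vector also holds on
      -- average over the uniform prior, whose mass cancels.
      uniform-success-bound : ∀ s {σ} → worstCaseQueries s ℕ.≤ q → (∀ x → σ ≤ success s x) → (1# + β) * σ ≤ 1#
      uniform-success-bound s {σ} s≤q σ≤ = *-cancelˡ-≤ (0<mass-prior N) (begin
        M * ((1# + β) * σ)
          ≈⟨ solve 3 (λ M b σ → M :* (b :* σ) := b :* (σ :* M)) ≈-refl M (1# + β) σ ⟩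
        (1# + β) * (σ * M)
          ≈⟨ *-congˡ (*-congˡ (∑-joint hs)) ⟨
        (1# + β) * (σ * ∑ N (joint hs))
          ≈⟨ *-congˡ (∑-scale N σ (joint hs)) ⟨
        (1# + β) * ∑ N (λ x → σ * joint hs x)
          ≤⟨ *-monoʳ-≤ 0≤1+β (∑-mono N λ x → ≤-trans (≤-reflexive (*-comm _ _)) (*-monoʳ-≤ (0≤joint hs x) (σ≤ x))) ⟩
        (1# + β) * ∑ N (λ x → joint hs x * success s x)
          ≤⟨ success-bound s hs (ℕ.≤-trans (ℕ.≤-reflexive (cong (ℕ._+ _) (totalCount-prior N))) s≤q) ⟩
        M
          ≈⟨ *-identityʳ M ⟨
        M * 1# ∎)
        where
        hs = prior N
        M = mass hs

-- Few answers leave much doubt.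

module _ {c ℓ₁ ℓ₂} (K : ArchimedeanOrderedField c ℓ₁ ℓ₂) where
  open ArchimedeanOrderedField K hiding (refl; zero)

  module ManyDoubts (p : Carrier) (0≤p : 0# ≤ p) (p+p≤1 : p + p ≤ 1#) where

    open OrderedField K
    open Guessing K p 0≤p p+p≤1
    open Belief
    open PartialOrderReasoning poset

    -- This is p^c ≥ (1 - c/k) p^k without division. Being linear in c, the bound can be summed
    -- knowing only the total number of answers, which replaces counting the bits with few answers.
    kp^k≤kp^c+cp^k : ∀ k c → ι k * p ^ k ≤ ι k * p ^ c + ι c * p ^ k
    kp^k≤kp^c+cp^k k c with ℕ.≤-total k c
    ... | inj₁ k≤c = begin
      ι k * p ^ k                  ≤⟨ *-monoˡ-≤ (0≤^ k 0≤p) (ι-mono-≤ k≤c) ⟩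
      ι c * p ^ k                  ≤⟨ x≤x+d _ (*-nonNegative (0≤ι k) (0≤^ c 0≤p)) ⟩
      ι c * p ^ k + ι k * p ^ c    ≈⟨ +-comm _ _ ⟩
      ι k * p ^ c + ι c * p ^ k    ∎
    ... | inj₂ c≤k = begin
      ι k * p ^ k                  ≤⟨ *-monoʳ-≤ (0≤ι k) (^-antitone 0≤p p≤1 c≤k) ⟩
      ι k * p ^ c                  ≤⟨ x≤x+d _ (*-nonNegative (0≤ι c) (0≤^ k 0≤p)) ⟩
      ι k * p ^ c + ι c * p ^ k    ∎

    doubt-tradeoff : ∀ {N} (hs : Vec Belief N) k →
                     ι (N ℕ.* k) * p ^ k ≤ ι k * doubt hs + ι (totalCount hs) * p ^ k
    doubt-tradeoff []       k = ≤-reflexive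
      (solve 2 (λ a b → con (0 , 0) :* b := a :* con (0 , 0) :+ con (0 , 0) :* b) ≈-refl (ι k) (p ^ k))
    doubt-tradeoff {suc N} (h ∷ hs) k = begin
      ι (k ℕ.+ N ℕ.* k) * x            ≈⟨ *-congʳ (ι-+ k (N ℕ.* k)) ⟩
      (ι k + ι (N ℕ.* k)) * x          ≈⟨ distribʳ x _ _ ⟩
      ι k * x + ι (N ℕ.* k) * x        ≤⟨ +-mono-≤ (kp^k≤kp^c+cp^k k (count h)) (doubt-tradeoff hs k) ⟩
      (ι k * y + ι (count h) * x) + (ι k * doubt hs + ι (totalCount hs) * x)
        ≈⟨ solve 6 (λ k y c x d t → (k :* y :+ c :* x) :+ (k :* d :+ t :* x) := k :* (y :+ d) :+ (c :+ t) :* x)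
                 ≈-refl (ι k) y (ι (count h)) x (doubt hs) (ι (totalCount hs)) ⟩
      ι k * (y + doubt hs) + (ι (count h) + ι (totalCount hs)) * x
        ≈⟨ +-congˡ (*-congʳ (ι-+ (count h) (totalCount hs))) ⟨
      ι k * (y + doubt hs) + ι (count h ℕ.+ totalCount hs) * x ∎
      where
      x = p ^ k
      y = p ^ count h

    -- If the answers number at most N k / 2, the tradeoff leaves doubt at least N p^k / 2, which is
    -- at least s M p^k and so at least s. All is multiplied by 2k.
    ≤doubt : ∀ {N} (hs : Vec Belief N) {q k M s} → totalCount hs ℕ.≤ q → 2 ℕ.* q ℕ.≤ N ℕ.* k → 1 ℕ.≤ k →
             2 ℕ.* (s ℕ.* M) ℕ.≤ N → 1# ≤ ι M * p ^ k → ι s ≤ doubt hs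
    ≤doubt {N} hs {q} {k} {M} {s} t≤q 2q≤Nk 1≤k 2sM≤N 1≤Mx =
      *-cancelˡ-≤ (0<ι 1≤2k) (begin
        ι (2 ℕ.* k) * ι s                      ≈⟨ *-identityʳ _ ⟨
        ι (2 ℕ.* k) * ι s * 1#
          ≤⟨ *-monoʳ-≤ (*-nonNegative (0≤ι (2 ℕ.* k)) (0≤ι s)) 1≤Mx ⟩
        ι (2 ℕ.* k) * ι s * (ι M * x)          ≈⟨ *-assoc _ _ _ ⟨
        ι (2 ℕ.* k) * ι s * ι M * x
          ≈⟨ *-congʳ (trans (*-congʳ (sym (ι-* (2 ℕ.* k) s))) (sym (ι-* (2 ℕ.* k ℕ.* s) M))) ⟩
        ι (2 ℕ.* k ℕ.* s ℕ.* M) * x            ≤⟨ *-monoˡ-≤ 0≤x (ι-mono-≤ 2ksM≤Nk) ⟩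
        ι (N ℕ.* k) * x
          -- Writing y as 2y - y lets the tradeoff be applied twice; the subtracted copy then
          -- outweighs both terms `ι t * x`, since 2t is at most N k.
          ≈⟨ solve 1 (λ y → y := (y :+ y) :- y) ≈-refl (ι (N ℕ.* k) * x) ⟩
        (ι (N ℕ.* k) * x + ι (N ℕ.* k) * x) - ι (N ℕ.* k) * x
          ≤⟨ +-mono-≤ (+-mono-≤ (doubt-tradeoff hs k) (doubt-tradeoff hs k)) (≤-refl { - (ι (N ℕ.* k) * x)}) ⟩
        ((ι k * d + ι t * x) + (ι k * d + ι t * x)) - ι (N ℕ.* k) * x
          ≤⟨ ≤-excess (*-nonNegative (0≤y-x 2t≤Nk) 0≤x) (solve 5 (λ k d t x n →
               ((k :* d :+ t :* x) :+ (k :* d :+ t :* x)) :- n :* x :+ (n :- (t :+ t)) :* x := (k :+ k) :* d)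
               ≈-refl (ι k) d (ι t) x (ι (N ℕ.* k))) ⟩
        (ι k + ι k) * d                        ≈⟨ *-congʳ (ι-double k) ⟨
        ι (2 ℕ.* k) * d                        ∎)
      where
      x = p ^ k
      d = doubt hs
      t = totalCount hs

      0≤x : 0# ≤ x
      0≤x = 0≤^ k 0≤p

      1≤2k : 1 ℕ.≤ 2 ℕ.* k
      1≤2k = ℕ.≤-trans 1≤k (ℕ.m≤m+n k _)

      ι-double : ∀ n → ι (2 ℕ.* n) ≈ ι n + ι n
      ι-double n = trans (ι-+ n (n ℕ.+ 0)) (+-congˡ (reflexive (cong ι (ℕ.+-identityʳ n))))

      2t≤Nk : ι t + ι t ≤ ι (N ℕ.* k)
      2t≤Nk = ≤-trans (≤-reflexive (sym (ι-double t)))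
                      (ι-mono-≤ (ℕ.≤-trans (ℕ.*-monoʳ-≤ 2 t≤q) 2q≤Nk))

      2ksM≤Nk : 2 ℕ.* k ℕ.* s ℕ.* M ℕ.≤ N ℕ.* k
      2ksM≤Nk = ℕ.≤-trans (ℕ.≤-reflexive (ℕSolver.+-*-Solver.solve 3 (λ k s M →
                  S.con 2 S.:* k S.:* s S.:* M S.:= S.con 2 S.:* (s S.:* M) S.:* k) refl k s M))
                  (ℕ.*-monoˡ-≤ k 2sM≤N)
        where module S = ℕSolver.+-*-Solver

-- Numerical thresholds for the lower bound.

n<2^n : ∀ n → n ℕ.< 2 ℕ.^ n
n<2^n zero    = s≤s z≤n
n<2^n (suc n) = ℕ.≤-trans (ℕ.+-mono-≤ (ℕ.m^n>0 2 n) (n<2^n n))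
                          (ℕ.≤-reflexive (cong (2 ℕ.^ n ℕ.+_) (≡.sym (ℕ.+-identityʳ _))))

2^⌊log₂n⌋≤n : ∀ {n} → 1 ℕ.≤ n → 2 ℕ.^ ⌊log₂ n ⌋ ℕ.≤ n
2^⌊log₂n⌋≤n {n} = go n (<-wellFounded n)
  where
  go : ∀ n → Acc ℕ._<_ n → 1 ℕ.≤ n → 2 ℕ.^ ⌊log₂ n ⌋ ℕ.≤ n
  go (suc zero)        _         _ = ℕ.≤-refl
  go n@(suc (suc n-2)) (acc rec) _ = begin
    2 ℕ.^ ⌊log₂ n ⌋
      ≡⟨ cong (2 ℕ.^_) (ℕ.m+[n∸m]≡n (2^≤⇒≤⌊log₂⌋ 1 {n} (s≤s (s≤s z≤n)))) ⟨
    2 ℕ.* 2 ℕ.^ (⌊log₂ n ⌋ ℕ.∸ 1)      ≡⟨ cong (λ l → 2 ℕ.* 2 ℕ.^ l) (⌊log₂⌊n/2⌋⌋≡⌊log₂n⌋∸1 n) ⟨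
    2 ℕ.* 2 ℕ.^ ⌊log₂ ⌊ n /2⌋ ⌋
      ≤⟨ ℕ.*-monoʳ-≤ 2 (go ⌊ n /2⌋ (rec (ℕ.⌊n/2⌋<n (suc n-2))) (s≤s z≤n)) ⟩
    2 ℕ.* ⌊ n /2⌋                      ≡⟨ cong (⌊ n /2⌋ ℕ.+_) (ℕ.+-identityʳ _) ⟩
    ⌊ n /2⌋ ℕ.+ ⌊ n /2⌋                ≤⟨ ℕ.+-monoʳ-≤ ⌊ n /2⌋ (ℕ.⌊n/2⌋≤⌈n/2⌉ n) ⟩
    ⌊ n /2⌋ ℕ.+ ⌈ n /2⌉                ≡⟨ ℕ.⌊n/2⌋+⌈n/2⌉≡n n ⟩
    n                                  ∎
    where open ℕ.≤-Reasoning

1+n≤4⌊n/2⌋ : ∀ {n} → 3 ℕ.≤ n → suc n ℕ.≤ 4 ℕ.* ⌊ n /2⌋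
1+n≤4⌊n/2⌋ {n} 3≤n = begin
  suc n                              ≡⟨ cong suc (ℕ.⌊n/2⌋+⌈n/2⌉≡n n) ⟨
  suc (h ℕ.+ ⌈ n /2⌉)                ≤⟨ s≤s (ℕ.+-monoʳ-≤ h (ℕ.⌊n/2⌋-mono (ℕ.n≤1+n (suc n)))) ⟩
  suc (h ℕ.+ suc h)
    ≡⟨ solve 1 (λ h → con 1 :+ (h :+ (con 1 :+ h)) := h :+ h :+ con 2) refl h ⟩
  h ℕ.+ h ℕ.+ 2                      ≤⟨ ℕ.+-monoʳ-≤ (h ℕ.+ h) (ℕ.*-monoʳ-≤ 2 (ℕ.⌊n/2⌋-mono 3≤n)) ⟩
  h ℕ.+ h ℕ.+ 2 ℕ.* h                ≡⟨ solve 1 (λ h → h :+ h :+ con 2 :* h := con 4 :* h) refl h ⟩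
  4 ℕ.* h                            ∎
  where
  h = ⌊ n /2⌋
  open ℕ.≤-Reasoning
  open ℕSolver.+-*-Solver

-- With k = ⌊log₂ m / 2j⌋ answers per hidden bit, M = 2^(j k) is at most √m.

module Thresholds (j s m : ℕ) (1≤j : 1 ℕ.≤ j)
                  (4≤m : 4 ℕ.≤ suc m) (2^2j≤m : 2 ℕ.^ (2 ℕ.* j) ℕ.≤ suc m)
                  ([8s]²≤m : (8 ℕ.* s) ℕ.* (8 ℕ.* s) ℕ.≤ suc m) where
  open ℕ.≤-Reasoning
  open ℕSolver.+-*-Solver

  instance
    2j≢0 : ℕ.NonZero (2 ℕ.* j)
    2j≢0 = ℕ.>-nonZero (ℕ.≤-trans 1≤j (ℕ.m≤m+n j _))

    j≢0 : ℕ.NonZero j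
    j≢0 = ℕ.>-nonZero 1≤j

  L = ⌊log₂ suc m ⌋
  k = L ℕ./ (2 ℕ.* j)
  M = 2 ℕ.^ (j ℕ.* k)
  N = ⌊ m /2⌋

  m≤4N : suc m ℕ.≤ 4 ℕ.* N
  m≤4N = 1+n≤4⌊n/2⌋ (ℕ.s≤s⁻¹ 4≤m)

  1≤N : 1 ℕ.≤ N
  1≤N = ℕ.⌊n/2⌋-mono (ℕ.≤-trans (ℕ.n≤1+n 2) (ℕ.s≤s⁻¹ 4≤m))

  1≤k : 1 ℕ.≤ k
  1≤k = ℕ.m≥n⇒m/n>0 (2^≤⇒≤⌊log₂⌋ (2 ℕ.* j) 2^2j≤m)

  -- Rounding in the division loses less than 2j, which is at most 2jk because k is at least 1.
  L≤4jk : L ℕ.≤ 4 ℕ.* (j ℕ.* k)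
  L≤4jk = begin
    L                                       ≡⟨ ℕ.m≡m%n+[m/n]*n L (2 ℕ.* j) ⟩
    L ℕ.% (2 ℕ.* j) ℕ.+ k ℕ.* (2 ℕ.* j)     ≤⟨ ℕ.+-monoˡ-≤ _ (ℕ.<⇒≤ (ℕ.m%n<n L (2 ℕ.* j))) ⟩
    2 ℕ.* j ℕ.+ k ℕ.* (2 ℕ.* j)             ≤⟨ ℕ.+-monoˡ-≤ _ (ℕ.m≤n*m (2 ℕ.* j) k {{ℕ.>-nonZero 1≤k}}) ⟩
    k ℕ.* (2 ℕ.* j) ℕ.+ k ℕ.* (2 ℕ.* j)
      ≡⟨ solve 2 (λ j k → k :* (con 2 :* j) :+ k :* (con 2 :* j) := con 4 :* (j :* k)) refl j k ⟩
    4 ℕ.* (j ℕ.* k)                         ∎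

  M²≤m : M ℕ.* M ℕ.≤ suc m
  M²≤m = begin
    M ℕ.* M                     ≡⟨ ℕ.^-distribˡ-+-* 2 (j ℕ.* k) (j ℕ.* k) ⟨
    2 ℕ.^ (j ℕ.* k ℕ.+ j ℕ.* k)
      ≤⟨ ℕ.^-monoʳ-≤ 2 (ℕ.≤-trans (ℕ.≤-reflexive jk+jk) (ℕ.m/n*n≤m L (2 ℕ.* j))) ⟩
    2 ℕ.^ L                     ≤⟨ 2^⌊log₂n⌋≤n (s≤s z≤n) ⟩
    suc m                       ∎
    where
    jk+jk : j ℕ.* k ℕ.+ j ℕ.* k ≡ k ℕ.* (2 ℕ.* j)
    jk+jk = solve 2 (λ j k → j :* k :+ j :* k := k :* (con 2 :* j)) refl j k

  -- The larger of 8s and M already has its square below the number of edges. The 8 is the 2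
  -- required by `≤doubt` times the 4 of `m≤4N`.
  8sM≤m : (8 ℕ.* s) ℕ.* M ℕ.≤ suc m
  8sM≤m with ℕ.≤-total (8 ℕ.* s) M
  ... | inj₁ 8s≤M = ℕ.≤-trans (ℕ.*-monoˡ-≤ M 8s≤M) M²≤m
  ... | inj₂ M≤8s = ℕ.≤-trans (ℕ.*-monoʳ-≤ (8 ℕ.* s) M≤8s) [8s]²≤m

  2sM≤N : 2 ℕ.* (s ℕ.* M) ℕ.≤ N
  2sM≤N = ℕ.*-cancelˡ-≤ 4 (begin
    4 ℕ.* (2 ℕ.* (s ℕ.* M))
      ≡⟨ solve 2 (λ s M → con 4 :* (con 2 :* (s :* M)) := con 8 :* s :* M) refl s M ⟩
    (8 ℕ.* s) ℕ.* M          ≤⟨ 8sM≤m ⟩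
    suc m                    ≤⟨ m≤4N ⟩
    4 ℕ.* N                  ∎)

  -- 32 = 2 · 4 · 4: the 2 from the conclusion, one 4 from `m≤4N`, the other from `L≤4jk`.
  few-queries : ∀ {q} → (32 ℕ.* j) ℕ.* q ℕ.< suc m ℕ.* L → 2 ℕ.* q ℕ.≤ N ℕ.* k
  few-queries {q} 32jq<mL = ℕ.*-cancelˡ-≤ (16 ℕ.* j) {{ℕ.m*n≢0 16 j}} (begin
    (16 ℕ.* j) ℕ.* (2 ℕ.* q)
      ≡⟨ solve 2 (λ j q → con 16 :* j :* (con 2 :* q) := con 32 :* j :* q) refl j q ⟩
    (32 ℕ.* j) ℕ.* q               ≤⟨ ℕ.<⇒≤ 32jq<mL ⟩
    suc m ℕ.* L                    ≤⟨ ℕ.*-mono-≤ m≤4N L≤4jk ⟩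
    (4 ℕ.* N) ℕ.* (4 ℕ.* (j ℕ.* k))
      ≡⟨ solve 3 (λ j k N → con 4 :* N :* (con 4 :* (j :* k)) := con 16 :* j :* (N :* k)) refl j k N ⟩
    (16 ℕ.* j) ℕ.* (N ℕ.* k)       ∎)

-- The hard instances: hubs 0 and 1 joined by an edge, and spokes 2 + v joined to both hubs (the last
-- one only to hub 0 if the number of edges is even). A hidden bit per two-edge spoke selects its
-- realized edge.

parity : ∀ {m} → Fin m → Bool
parity zero          = false
parity (suc zero)    = true
parity (suc (suc e)) = parity e

half : ∀ {m} → Fin m → Fin ⌈ m /2⌉
half {suc zero}    zero          = zero
half {suc (suc m)} zero          = zero
half {suc (suc m)} (suc zero)    = zero
half {suc (suc m)} (suc (suc e)) = suc (half e)

parity-half-injective : ∀ {m} (e f : Fin m) → parity e ≡ parity f → half e ≡ half f → e ≡ f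
parity-half-injective zero          zero          _  _  = refl
parity-half-injective {suc (suc m)} zero (suc zero) () _
parity-half-injective {suc (suc m)} zero (suc (suc f)) _ ()
parity-half-injective {suc (suc m)} (suc zero) zero () _
parity-half-injective {suc (suc m)} (suc zero) (suc zero) _ _ = refl
parity-half-injective {suc (suc m)} (suc zero) (suc (suc f)) _ ()
parity-half-injective {suc (suc m)} (suc (suc e)) zero _ ()
parity-half-injective {suc (suc m)} (suc (suc e)) (suc zero) _ ()
parity-half-injective {suc (suc m)} (suc (suc e)) (suc (suc f)) p h =
  cong (λ e → suc (suc e)) (parity-half-injective e f p (Fin.suc-injective h))

-- The edge to hub 1 is realized exactly when the bit is true, otherwise the edge to hub 0. A
-- leftover spoke must keep its only edge to stay connected.
encode : ∀ m → Vec Bool ⌊ m /2⌋ → Subset m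
encode zero          _       = []
encode (suc zero)    _       = true ∷ []
encode (suc (suc m)) (b ∷ x) = not b ∷ b ∷ encode m x

decode : ∀ m → Subset m → Vec Bool ⌊ m /2⌋
decode zero          _           = []
decode (suc zero)    _           = []
decode (suc (suc m)) (_ ∷ b ∷ T) = b ∷ decode m T

-- Necessary for connectedness, as spokes are adjacent only to hubs, and sufficient once the hub
-- edge is added.
Covers : ∀ {m} → Subset m → Set
Covers {m} T = ∀ v → ∃[ e ] e ∈ T × half {m} e ≡ v

encode-covers : ∀ m x → Covers (encode m x)
encode-covers (suc zero)    _           zero    = zero , Vec.here , refl
encode-covers (suc (suc m)) (true ∷ x)  zero    = suc zero , Vec.there Vec.here , refl
encode-covers (suc (suc m)) (false ∷ x) zero    = zero , Vec.here , refl
encode-covers (suc (suc m)) (b ∷ x)     (suc v) with encode-covers m x v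
... | e , e∈ , refl = suc (suc e) , Vec.there (Vec.there e∈) , refl

-- Each two-edge spoke has one edge available in `encode m x`, and `T` must take at least one edge
-- there, so the choice is forced.
decode-⊆-encode : ∀ m x T → T ⊆ encode m x → Covers T → decode m T ≡ x
decode-⊆-encode zero          []      _           _  _      = refl
decode-⊆-encode (suc zero)    []      _           _  _      = refl
decode-⊆-encode (suc (suc m)) (y ∷ x) (a ∷ b ∷ T) T⊆ covers =
  cong₂ _∷_ (head b T⊆ (covers zero)) (decode-⊆-encode m x T (Subset.drop-∷-⊆ (Subset.drop-∷-⊆ T⊆)) rest)
  where
  head : ∀ b → a ∷ b ∷ T ⊆ not y ∷ y ∷ encode m x →
         (∃[ e ] e ∈ a ∷ b ∷ T × half e ≡ zero) → b ≡ y
  head true  T⊆ _ with T⊆ (Vec.there Vec.here)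
  ... | Vec.there Vec.here = refl
  head false T⊆ (zero , e∈ , _) = not-true (Vec.[]=⇒lookup (T⊆ e∈))
    where
    not-true : ∀ {y} → not y ≡ true → false ≡ y
    not-true {false} _ = refl
  head false T⊆ (suc zero , Vec.there () , _)
  head false T⊆ (suc (suc _) , _ , ())

  rest : Covers T
  rest v with covers (suc v)
  ... | suc (suc e) , Vec.there (Vec.there e∈) , eq = e , e∈ , Fin.suc-injective eq

encode-lookup : ∀ m e →
  (∃[ i ] Σ[ f ∈ (Bool → Bool) ] ∀ x → Vec.lookup (encode m x) e ≡ f (Vec.lookup x i)) ⊎
  (∀ x → Vec.lookup (encode m x) e ≡ true)
encode-lookup (suc zero)    zero          = inj₂ λ _ → refl
encode-lookup (suc (suc m)) zero          = inj₁ (zero , not , λ { (_ ∷ _) → refl })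
encode-lookup (suc (suc m)) (suc zero)    = inj₁ (zero , id , λ { (_ ∷ _) → refl })
encode-lookup (suc (suc m)) (suc (suc e)) with encode-lookup m e
... | inj₁ (i , f , eq) = inj₁ (suc i , f , λ { (_ ∷ x) → eq x })
... | inj₂ eq           = inj₂ λ { (_ ∷ x) → eq x }

record HiddenBits (N m : ℕ) : Set where
  field
    {n}                : ℕ
    moldgraph          : Moldgraph n m
    realized           : Vec Bool N → Subset m
    realized-connected : ∀ x → Connected (Moldgraph.graph moldgraph) (realized x)
    observed           : ∀ e → ∃[ i ] Σ[ f ∈ (Bool → Bool) ] ∀ x →
                         Vec.lookup (realized x) e ≡ f (Vec.lookup x i)
    revealed           : Subset m → Vec Bool N
    tree-reveals       : ∀ x T → IsRealizedSpanningTree (Moldgraph.graph moldgraph) (realized x) T →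
                         revealed T ≡ x

module HardInstance (m : ℕ) where

  hub : Bool → Fin (2 ℕ.+ ⌈ m /2⌉)
  hub false = zero
  hub true  = suc zero

  spoke : Fin ⌈ m /2⌉ → Fin (2 ℕ.+ ⌈ m /2⌉)
  spoke v = suc (suc v)

  hub-injective : ∀ {a b} → hub a ≡ hub b → a ≡ b
  hub-injective {a = false} {false} _ = refl
  hub-injective {a = true}  {true}  _ = refl

  hub≢spoke : ∀ {b v} → hub b ≢ spoke v
  hub≢spoke {false} ()
  hub≢spoke {true} ()

  endpoints : Fin (suc m) → Fin (2 ℕ.+ ⌈ m /2⌉) × Fin (2 ℕ.+ ⌈ m /2⌉)
  endpoints zero    = hub false , hub true
  endpoints (suc e) = hub (parity e) , spoke (half e)

  hub<spoke : ∀ b v → hub b Fin.< spoke v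
  hub<spoke false v = s≤s z≤n
  hub<spoke true  v = s≤s (s≤s z≤n)

  graph : Graph (2 ℕ.+ ⌈ m /2⌉) (suc m)
  graph = record
    { ends           = endpoints
    ; ends-<         = λ { zero → s≤s z≤n ; (suc e) → hub<spoke (parity e) (half e) }
    ; ends-injective = injective _ _
    }
    where
    injective : ∀ e f → endpoints e ≡ endpoints f → e ≡ f
    injective zero    zero    _  = refl
    injective zero    (suc f) eq with () ← cong proj₂ eq
    injective (suc e) zero    eq with () ← cong proj₂ eq
    injective (suc e) (suc f) eq = cong suc (parity-half-injective e f
      (hub-injective (cong proj₁ eq))
      (Fin.suc-injective (Fin.suc-injective (cong proj₂ eq))))

  open Trees graph

  realized : Vec Bool ⌊ m /2⌋ → Subset (suc m)
  realized x = true ∷ encode m x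

  realized-connected : ∀ x → Connected graph (realized x)
  realized-connected x u v = star-sym (reach u) ◅◅ reach v
    where
    reach-hub : ∀ b → Star (Adj graph (realized x)) (hub false) (hub b)
    reach-hub false = ε
    reach-hub true  = (zero , Vec.here , inj₁ refl) ◅ ε

    reach : ∀ v → Star (Adj graph (realized x)) (hub false) v
    reach zero          = reach-hub false
    reach (suc zero)    = reach-hub true
    reach (suc (suc v)) with encode-covers m x v
    ... | e , e∈ , refl = reach-hub (parity e) ◅◅ ((suc e , Vec.there e∈ , inj₁ refl) ◅ ε)

  moldgraph : Moldgraph (2 ℕ.+ ⌈ m /2⌉) (suc m)
  moldgraph = record
    { graph     = graph
    ; connected = connected-mono {T = ⊤} (λ _ → Subset.∈⊤) (realized-connected (Vec.replicate _ false))
    }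

  -- A path from a spoke to a hub is nonempty, and its first edge is the covering one.
  connected⇒covers : ∀ {a T} → Connected graph (a ∷ T) → Covers T
  connected⇒covers {a} {T} conn v with conn (spoke v) (hub false)
  ... | (zero , _ , inj₁ eq) ◅ _ with () ← cong proj₁ eq
  ... | (zero , _ , inj₂ eq) ◅ _ with () ← cong proj₂ eq
  ... | (suc e , _ , inj₁ eq) ◅ _ = ⊥-elim (hub≢spoke {parity e} (cong proj₁ eq))
  ... | (suc e , Vec.there e∈ , inj₂ eq) ◅ _ =
    e , e∈ , Fin.suc-injective (Fin.suc-injective (cong proj₂ eq))

  tree-reveals : ∀ x T → IsRealizedSpanningTree graph (realized x) T → decode m (Vec.tail T) ≡ x
  tree-reveals x (_ ∷ T) (T⊆ , conn , _) =
    decode-⊆-encode m x T (Subset.drop-∷-⊆ T⊆) (connected⇒covers conn)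

  observed : 1 ℕ.≤ ⌊ m /2⌋ → ∀ e →
    ∃[ i ] Σ[ f ∈ (Bool → Bool) ] ∀ x → Vec.lookup (realized x) e ≡ f (Vec.lookup x i)
  -- An edge that is always realized is charged to an arbitrary bit through a constant function;
  -- `1≤N` supplies such a bit.
  observed 1≤N zero = Fin.fromℕ< 1≤N , (λ _ → true) , λ _ → refl
  observed 1≤N (suc e) with encode-lookup m e
  ... | inj₁ bit  = bit
  ... | inj₂ sure = Fin.fromℕ< 1≤N , (λ _ → true) , sure

  hiddenBits : 1 ℕ.≤ ⌊ m /2⌋ → HiddenBits ⌊ m /2⌋ (suc m)
  hiddenBits 1≤N = record
    { moldgraph          = moldgraph
    ; realized           = realized
    ; realized-connected = realized-connected
    ; observed           = observed 1≤N
    ; revealed           = decode m ∘ Vec.tail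
    ; tree-reveals       = tree-reveals
    }

-- The lower bound: choice of constants and contradiction.

module _ {c ℓ₁ ℓ₂} (K : ArchimedeanOrderedField c ℓ₁ ℓ₂) where
  open ArchimedeanOrderedField K hiding (refl; zero)

  module LowerBoundTheorem (p : Carrier) (p+p≤1 : p + p ≤ 1#) (0<p : 0# < p)
                           (δ : Carrier) (δ<1 : δ < 1#) where

    open OrderedField K
    open Querying K
    open PartialOrderReasoning poset

    0≤p : 0# ≤ p
    0≤p = proj₁ 0<p

    open Guessing K p 0≤p p+p≤1
    open ManyDoubts K p 0≤p p+p≤1

    σ : Carrier
    σ = 1# - δ

    0<σ : 0# < σ
    0<σ = 0<y-x δ<1

    1/p 1/σ : ℕ
    1/p = proj₁ (archimedean* 0<p 1#)
    1/σ = proj₁ (archimedean* 0<σ 1#)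

    -- `2 ^ j` exceeds `1/p`, which gives 2^j p ≥ 1; the successor keeps 2j a legal divisor.
    j : ℕ
    j = suc 1/p

    1≤2^jp : 1# ≤ ι (2 ℕ.^ j) * p
    1≤2^jp = begin
      1#                 ≤⟨ proj₂ (archimedean* 0<p 1#) ⟩
      ι 1/p * p          ≤⟨ *-monoˡ-≤ 0≤p (ι-mono-≤ (ℕ.≤-trans (ℕ.n≤1+n _) (ℕ.<⇒≤ (n<2^n j)))) ⟩
      ι (2 ℕ.^ j) * p    ∎

    1≤2^jkp^k : ∀ k → 1# ≤ ι (2 ℕ.^ (j ℕ.* k)) * p ^ k
    1≤2^jkp^k k = begin
      1#                              ≤⟨ 1≤^ k 1≤2^jp ⟩
      (ι (2 ℕ.^ j) * p) ^ k           ≈⟨ ^-distrib-* _ p k ⟩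
      ι (2 ℕ.^ j) ^ k * p ^ k         ≈⟨ *-congʳ (ι-^ (2 ℕ.^ j) k) ⟨
      ι ((2 ℕ.^ j) ℕ.^ k) * p ^ k     ≈⟨ *-congʳ (reflexive (cong ι (ℕ.^-*-assoc 2 j k))) ⟩
      ι (2 ℕ.^ (j ℕ.* k)) * p ^ k     ∎

    -- `ι 1/σ * σ` is already at least 1, so one more `σ` overshoots. This is why doubt of at least
    -- `ι 1/σ` is incompatible with success probability `σ`.
    [1+1/σ]σ≰1 : ¬ (1# + ι 1/σ) * σ ≤ 1#
    [1+1/σ]σ≰1 ≤1 = <⇒≱ 0<σ (begin
      σ
        ≈⟨ solve 2 (λ σ y → σ := (one :+ y) :* σ :- y :* σ) ≈-refl σ (ι 1/σ) ⟩
      (1# + ι 1/σ) * σ - ι 1/σ * σ  ≤⟨ +-monoˡ-≤ _ ≤1 ⟩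
      1# - ι 1/σ * σ                ≤⟨ +-monoˡ-≤ _ (proj₂ (archimedean* 0<σ 1#)) ⟩
      ι 1/σ * σ - ι 1/σ * σ         ≈⟨ -‿inverseʳ _ ⟩
      0#                            ∎)

    -- The summands serve separate purposes: 4 gives a hidden bit and `m≤4N`, the power of 2 gives
    -- `1≤k`, and the square gives `8sM≤m`.
    m₀ : ℕ
    m₀ = 4 ℕ.+ (2 ℕ.^ (2 ℕ.* j) ℕ.+ (8 ℕ.* 1/σ) ℕ.* (8 ℕ.* 1/σ))

    too-few-queries : ∀ {m N k M} (H : HiddenBits N m) (A : Algorithm) → SucceedsOnSize p A m δ →
                      1 ℕ.≤ k → 2 ℕ.* (1/σ ℕ.* M) ℕ.≤ N → 1# ≤ ι M * p ^ k →
                      ¬ 2 ℕ.* worstCaseQueries (A (HiddenBits.moldgraph H)) ℕ.≤ N ℕ.* k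
    too-few-queries {k = k} {M} H A succeeds 1≤k 2sM≤N 1≤Mp^k 2q≤Nk =
      [1+1/σ]σ≰1 (uniform-success-bound realized observed
        (λ x → isRealizedSpanningTree? graph (realized x)) revealed tree-reveals
        (0≤ι 1/σ) (λ hs t≤q → ≤doubt hs {k = k} {M} {1/σ} t≤q 2q≤Nk 1≤k 2sM≤N 1≤Mp^k)
        (A moldgraph) ℕ.≤-refl (λ x → succeeds moldgraph (realized x) (realized-connected x)))
      where
      open HiddenBits H
      open Moldgraph moldgraph using (graph)

    query-bound : ∀ (A : Algorithm) m → m₀ ℕ.≤ m → SucceedsOnSize p A m δ →
                  ∃[ n ] Σ[ G ∈ Moldgraph n m ] m ℕ.* ⌊log₂ m ⌋ ℕ.≤ (32 ℕ.* j) ℕ.* worstCaseQueries (A G)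
    query-bound A (suc m) m₀≤m succeeds = _ , moldgraph , ℕ.≮⇒≥ λ few →
      too-few-queries {k = k} {M} (hiddenBits 1≤N) A succeeds 1≤k 2sM≤N (1≤2^jkp^k k) (few-queries few)
      where
      open HardInstance m
      open Thresholds j 1/σ m (s≤s z≤n)
        (ℕ.m+n≤o⇒m≤o 4 m₀≤m)
        (ℕ.m+n≤o⇒m≤o _ (ℕ.m+n≤o⇒n≤o 4 m₀≤m))
        (ℕ.m+n≤o⇒n≤o (2 ℕ.^ (2 ℕ.* j)) (ℕ.m+n≤o⇒n≤o 4 m₀≤m))

open import Data.Nat using (_*_; _≤_)

theorem2 :
  ∀ {c ℓ₁ ℓ₂} (K : ArchimedeanOrderedField c ℓ₁ ℓ₂) →
  let module K = ArchimedeanOrderedField K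
      open Querying K
  in
  (p : K.Carrier) → K.0# K.≤ p → (p K.+ p) K.< K.1# →
  (Σ[ A ∈ Algorithm ]
     SucceedsWithHighProbability p A ×
     (∃[ C ] ∃[ m₀ ] ∀ {n} m → m₀ ≤ m → (G : Moldgraph n m) →
        worstCaseQueries (A G) ≤ C * (m * ⌊log₂ m ⌋)))
  ×
  (K.0# K.< p →
   ∀ δ → δ K.< K.1# →
   ∃[ C ] ∃[ m₀ ] ∀ (A : Algorithm) m → m₀ ≤ m →
     SucceedsOnSize p A m δ →
     ∃[ n ] Σ[ G ∈ Moldgraph n m ] m * ⌊log₂ m ⌋ ≤ C * worstCaseQueries (A G))
theorem2 K p 0≤p p+p<1 =
  (Upper.algorithm , Upper.succeeds , 2 * Upper.j , 2 , Upper.query-bound) ,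
  λ 0<p δ δ<1 →
    let module Lower = LowerBoundTheorem K p (proj₁ p+p<1) 0<p δ δ<1
    in 32 * Lower.j , Lower.m₀ , Lower.query-bound
  where module Upper = UpperBoundTheorem K p 0≤p p+p<1
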